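{- Let $\mathcal{G}$ and $\mathcal{H}$ be two hypergraphs on the vertex set $V$ and let $n=\|\mathcal{G}\|+\|\mathcal{H}\|$. The problem of deciding whether $\mathcal{G}$ and $\mathcal{H}$ are not dual (the problem co-DUAL) belongs to $\mathrm{GC}(\log^2 n,\mathrm{TC}^0)$.
   Context: A hypergraph $\mathcal{G}=\langle V,E\rangle$ has a finite vertex set $V$ and an edge set $E\subseteq 2^V$; we identify $\mathcal{G}$ with its edge set. Standing assumptions: the two hypergraphs share the vertex set $V$, every vertex belongs to some edge, and (unless explicitly said otherwise) hypergraphs are non-empty and do not contain the empty edge. A transversal of $\mathcal{G}$ is a set $T\subseteq V$ meeting every edge; it is minimal if no proper subset is a transversal; $tr(\mathcal{G})$ denotes the hypergraph of minimal transversals of $\mathcal{G}$. $\mathcal{G}$ and $\mathcal{H}$ are dual if $\mathcal{H}=tr(\mathcal{G})$. $\|\mathcal{G}\|$ is the number of bits needed to represent $\mathcal{G}$, given by the adjacency lists of its edges. For a function $f$ and a complexity class $\mathcal{C}$, $\mathrm{GC}(f(n),\mathcal{C})$ is the class of problems that, after a nondeterministic guess of $O(f(n))$ bits, can be decided (checked) within $\mathcal{C}$ (i.e., the input is a yes-instance iff some guess of $O(f(n))$ bits makes the $\mathcal{C}$-check accept). $\mathrm{TC}^0$ denotes logtime-uniform $\mathrm{TC}^0$, equivalently the problems definable in first-order logic with counting quantifiers FO(COUNT). -}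

module Defs where

open import Data.Nat using (ℕ; zero; suc; _+_; _*_; _^_; _≤_; ⌊_/2⌋)
open import Data.Nat.Logarithm using (⌈log₂_⌉)
open import Data.Bool using (Bool; true; false; if_then_else_; not; _∧_; _∨_)
open import Data.Fin using (Fin; toℕ; #_)
open import Data.Fin.Subset using (Subset; _∈_; _⊂_; Nonempty)
open import Data.List using (List; []; _∷_; _++_; length; map; concatMap; allFin; lookup)
open import Data.Bool.ListAction using (any)
open import Data.Nat.ListAction using (sum)
open import Data.List.Relation.Unary.All using (All)
open import Data.List.Relation.Unary.Any using (Any)
open import Data.List.Relation.Unary.Unique.Propositional using (Unique)
open import Data.Product using (Σ; ∃; _×_)
open import Data.Vec using (Vec)
import Data.Vec as Vec
open import Relation.Binary.PropositionalEquality using (_≡_)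
open import Relation.Nullary using (¬_; does)
open import Function.Bundles using (_⇔_)
import Data.Fin as F
import Data.Nat as N

-- Hypergraphs on the vertex set V = Fin m.
-- A hypergraph is given by the list of its edges; each edge is a subset
-- of V (a characteristic vector).  Edges are pairwise distinct (an edge
-- *set*); the list order is the order used in the adjacency-list encoding.

record Hypergraph (m : ℕ) : Set where
  constructor hyp
  field
    edges    : List (Subset m)
    distinct : Unique edges
open Hypergraph public

_∈E_ : ∀ {m} → Subset m → Hypergraph m → Set
S ∈E G = Any (S ≡_) (edges G)

Transversal : ∀ {m} → Hypergraph m → Subset m → Set
Transversal G T = All (λ E → ∃ λ v → v ∈ T × v ∈ E) (edges G)

MinTransversal : ∀ {m} → Hypergraph m → Subset m → Set
MinTransversal G T = Transversal G T × (∀ T′ → T′ ⊂ T → ¬ Transversal G T′)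

Dual : ∀ {m} → Hypergraph m → Hypergraph m → Set
Dual G H = ∀ S → (S ∈E H) ⇔ MinTransversal G S

WellFormed : ∀ {m} → Hypergraph m → Set
WellFormed {m} G =
  (∃ λ E → E ∈E G) × All Nonempty (edges G) × (∀ (v : Fin m) → ∃ λ E → E ∈E G × v ∈ E)

-- Binary encoding of an instance as a word over a 5-letter alphabet
-- 0:'0'  1:'1'  2:','  3:';'  4:'#'.

isOdd : ℕ → Bool
isOdd zero = false
isOdd (suc n) = not (isOdd n)

bitAt : ℕ → ℕ → Bool
bitAt x zero = isOdd x
bitAt x (suc j) = bitAt ⌊ x /2⌋ j

bitSym : Bool → Fin 5
bitSym false = # 0
bitSym true  = # 1

binary : ℕ → ℕ → List (Fin 5)
binary width x = map (λ j → bitSym (bitAt x (toℕ j))) (allFin width)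

encVertex : ∀ {m} → Fin m → List (Fin 5)
encVertex {m} v = binary ⌈log₂ (suc m) ⌉ (toℕ v)

encEdge : ∀ {m} → Subset m → List (Fin 5)
encEdge {m} S =
  concatMap (λ v → if Vec.lookup S v then encVertex v ++ (# 2 ∷ []) else []) (allFin m)

encHyp : ∀ {m} → Hypergraph m → List (Fin 5)
encHyp G = concatMap (λ S → encEdge S ++ (# 3 ∷ [])) (edges G)

encInst : ∀ {m} → Hypergraph m → Hypergraph m → List (Fin 5)
encInst G H = encHyp G ++ (# 4 ∷ encHyp H)

-- FO(COUNT) over finite words (= logtime-uniform TC⁰), following
-- Barrington–Immerman–Straubing: variables range over positions,
-- atomic predicates Q_a(x), x = y, x < y, BIT(x,y), connectives,
-- ∃, and the counting quantifier  ∃^{=i} y. φ  ("exactly i positions y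
-- satisfy φ", i a variable).  Variables are de Bruijn indices.

data Form (s : ℕ) : ℕ → Set where
  sym  : ∀ {k} → Fin s → Fin k → Form s k
  eq   : ∀ {k} → Fin k → Fin k → Form s k
  lt   : ∀ {k} → Fin k → Fin k → Form s k
  bit  : ∀ {k} → Fin k → Fin k → Form s k
  neg  : ∀ {k} → Form s k → Form s k
  and  : ∀ {k} → Form s k → Form s k → Form s k
  ex   : ∀ {k} → Form s (suc k) → Form s k
  cnt  : ∀ {k} → Fin k → Form s (suc k) → Form s k

Sentence : ℕ → Set
Sentence s = Form s 0

extend : ∀ {k n} → Fin n → (Fin k → Fin n) → Fin (suc k) → Fin n
extend p ρ F.zero = p
extend p ρ (F.suc i) = ρ i

eval : ∀ {s k} (w : List (Fin s)) → Form s k → (Fin k → Fin (length w)) → Bool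
eval w (sym a x) ρ = does (lookup w (ρ x) F.≟ a)
eval w (eq x y) ρ = does (ρ x F.≟ ρ y)
eval w (lt x y) ρ = does (ρ x F.<? ρ y)
eval w (bit x y) ρ = bitAt (toℕ (ρ x)) (toℕ (ρ y))
eval w (neg φ) ρ = not (eval w φ ρ)
eval w (and φ ψ) ρ = eval w φ ρ ∧ eval w ψ ρ
eval w (ex φ) ρ = any (λ p → eval w φ (extend p ρ)) (allFin (length w))
eval w (cnt i φ) ρ =
  does (sum (map (λ p → if eval w φ (extend p ρ) then 1 else 0) (allFin (length w)))
        N.≟ toℕ (ρ i))

Accepts : ∀ {s} → Sentence s → List (Fin s) → Set
Accepts φ w = eval w φ (λ ()) ≡ true

-- Input for the checker: the instance word, a separator, then the guessed
-- bits.  Alphabet Fin 8: 0..4 instance symbols, 5 separator, 6 / 7 guess bits.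

guessSym : Bool → Fin 8
guessSym false = # 6
guessSym true  = # 7

checkerWord : List (Fin 5) → List Bool → List (Fin 8)
checkerWord x y = map (F._↑ˡ 3) x ++ (# 5 ∷ map guessSym y)

CoDualInGC-log²-TC⁰ : Set
CoDualInGC-log²-TC⁰ =
  Σ ℕ λ c → Σ (Sentence 8) λ φ →
    ∀ (m : ℕ) (G H : Hypergraph m) → WellFormed G → WellFormed H →
      (¬ Dual G H) ⇔
      (∃ λ (y : List Bool) →
         length y ≤ c * ⌈log₂ (length (encInst G H)) ⌉ ^ 2 + c
         × Accepts φ (checkerWord (encInst G H) y))

{-# OPTIONS --safe #-}
module Submission where

open import Defs
open import Data.Bool using (Bool; true; false; if_then_else_; not; _∧_; _∨_) renaming (_≟_ to _≟ᵇ_)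
open import Data.Bool.ListAction using (any)
open import Data.Bool.Properties using (∧-zeroʳ; ∧-identityʳ)
open import Data.Empty using (⊥; ⊥-elim)
open import Data.Fin using (Fin; toℕ; fromℕ<; #_)
import Data.Fin as F
import Data.Fin.Properties as FP
open import Data.Fin.Subset using (Subset; _∈_; _∉_; _⊆_; _⊂_; _-_)
open import Data.Fin.Subset.Induction using (⊂-wellFounded)
open import Data.Fin.Subset.Properties
  using (_∈?_; anySubset?; x∈p⇒p-x⊂p; x∈p∧x≢y⇒x∈p-y; ⊆-antisym; ⊆-trans; ⊆-refl)
open import Data.List
  using (List; []; _∷_; _++_; length; map; allFin; lookup; tabulate; foldr; concatMap; filter)
open import Data.List.Membership.Propositional using (find; lose) renaming (_∈_ to _∈ˡ_)
open import Data.List.Membership.Propositional.Properties using (∈-length; ∈-filter⁺; ∈-allFin)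
open import Data.List.Properties
  using (map-tabulate; map-cong; length-++; length-map; length-tabulate; length-filter; map-++;
         map-concatMap; concatMap-cong; ++-assoc; ++-identityʳ)
open import Data.List.Relation.Unary.All as All using (All; []; _∷_)
import Data.List.Relation.Unary.All.Properties as All
open import Data.List.Relation.Unary.Any as Any using (Any; here; there)
open import Data.Maybe using (Maybe; just; nothing; maybe′)
open import Data.Maybe.Properties using (just-injective)
open import Data.Nat hiding (compare)
open import Data.Nat.Induction using (<-rec)
open import Data.Nat.ListAction using (sum)
open import Data.Nat.Logarithm using (⌈log₂_⌉; ⌈log₂⌈n/2⌉⌉≡⌈log₂n⌉∸1; ⌈log₂⌉-mono-≤)
open import Data.Nat.Properties
open import Data.Product as Product using (∃; _×_; _,_; proj₁; proj₂)
open import Data.Sum as Sum using (_⊎_; inj₁; inj₂)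
open import Data.Unit using (⊤; tt)
import Data.Vec as Vec
import Data.Vec.Properties as Vec
open import Function using (_∘_; id; _⇔_; mk⇔; Equivalence)
open import Induction.WellFounded using (Acc; acc)
open import Relation.Binary.Definitions using (tri<; tri≈; tri>)
open import Relation.Binary.PropositionalEquality renaming (sym to ≡-sym)
open import Relation.Nullary
open import Relation.Nullary.Decidable
  using (map′; _×-dec_; _⊎-dec_; ¬?; decidable-stable; dec-true; dec-false)
open import Relation.Nullary.Reflects using (invert; ¬-reflects; _×-reflects_)
open import Relation.Unary using (Decidable)
open Equivalence using (to; from)

{-
Let T be a minimal transversal of G containing no edge of H, where all edges of H are minimal
transversals of G.  A set X of vertices outside T is grown by labels; call an edge of H live if it
is disjoint from X, and a vertex outside X frequent if it lies in at least half of the live edges.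
If the frequent vertices form a transversal of G containing no edge of H, X is a certificate.
Otherwise one more label at least halves the number of live edges: either exclude a frequent vertex
outside T, or exclude S ∖ {v} for an infrequent v ∈ T and an edge S of G with S ∩ T = {v}; since
every edge of H meets S, only live edges through v survive the latter.  So about log |H| labels
suffice.  A label is a position of the input: the comma ending a code of v stands for
the exclusion of v, a digit of the code of v in the edge S for the exclusion of S ∖ {v}.  Each label
takes O(log n) guessed bits, and the frequent vertices are defined from the labels by counting.
-}

-- Certificates of non-duality

-- Soundness does not depend on the guess being well formed. Whatever the guess, the formula picks
-- out some set of vertices, and the check that this set meets every edge of `G` and contains no
-- edge of `H` is itself a proof of non-duality. So only honest guesses have to be decoded
-- correctly. The transversal T steers the choice of labels but is never guessed: writing it down
-- could take far more than log² n bits. It can be dispensed with because the frequent vertices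
-- depend on the labels alone. The other way to fail duality, an edge of `H` that is not a minimal
-- transversal, is first-order and needs no guess. A pair of an edge and a vertex is coded as one
-- position, so that every label costs a single number below n. The formula does not know how many
-- bits such a number takes, and therefore the guess is self-delimiting: blocks have recognisable
-- headers, each bit contributes exactly one zero, and the index of a bit is found by counting
-- zeros.

count : ∀ {A : Set} {P : A → Set} → Decidable P → List A → ℕ
count P? xs = length (filter P? xs)

count-mono : ∀ {A : Set} {P Q : A → Set} (P? : Decidable P) (Q? : Decidable Q) (xs : List A) →
             (∀ x → x ∈ˡ xs → P x → Q x) → count P? xs ≤ count Q? xs
count-mono P? Q? [] imp = z≤n
count-mono P? Q? (x ∷ xs) imp with P? x | Q? x | count-mono P? Q? xs (λ y → imp y ∘ there)
... | yes p | yes q | ih = s≤s ih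
... | yes p | no ¬q | ih = ⊥-elim (¬q (imp x (here refl) p))
... | no ¬p | yes q | ih = m≤n⇒m≤1+n ih
... | no ¬p | no ¬q | ih = ih

count-split : ∀ {A : Set} {P Q : A → Set} (P? : Decidable P) (Q? : Decidable Q) (xs : List A) →
              count P? xs ≡ count (λ x → P? x ×-dec Q? x) xs + count (λ x → P? x ×-dec ¬? (Q? x)) xs
count-split P? Q? [] = refl
count-split P? Q? (x ∷ xs) with P? x | Q? x | count-split P? Q? xs
... | yes p | yes q | ih = cong suc ih
... | yes p | no ¬q | ih = trans (cong suc ih) (≡-sym (+-suc _ _))
... | no ¬p | _ | ih = ih

half-< : ∀ {a b k} → a + b < 2 ^ suc k → a ≤ b → a < 2 ^ k
half-< {a} {b} {k} a+b< a≤b = *-cancelˡ-< 2 a (2 ^ k)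
    (≤-<-trans (+-monoʳ-≤ a (≤-trans (≤-reflexive (+-identityʳ a)) a≤b)) a+b<)

module Duality {m : ℕ} (G H : Hypergraph m) where

  Meets : Subset m → Subset m → Set
  Meets S T = ∃ λ v → v ∈ S × v ∈ T

  meets? : ∀ S T → Dec (Meets S T)
  meets? S T = FP.any? λ v → (v ∈? S) ×-dec (v ∈? T)

  transversal? : Decidable (Transversal G)
  transversal? T = All.all? (meets? T) (edges G)

  missed : ∀ {T} → ¬ Transversal G T → ∃ λ g → g ∈ˡ edges G × ¬ Meets T g
  missed {T} = find ∘ All.¬All⇒Any¬ (meets? T) (edges G)

  -- Failure of minimality with quantifiers over edges and vertices only, so that a formula can
  -- follow it clause by clause; `MinTransversal` itself quantifies over subsets.
  Defective : Subset m → Set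
  Defective e =
    (∃ λ g → g ∈ˡ edges G × ¬ (∃ λ v → v ∈ e × v ∈ g)) ⊎
    (∃ λ v → v ∈ e × ¬ (∃ λ g → g ∈ˡ edges G × ¬ (∃ λ u → u ∈ e × u ∈ g × u ≢ v)))

  -- By minimality `T - v` misses some edge `g`; since `T` meets `g`, it can do so only in `v`.
  critical : ∀ {T v} → MinTransversal G T → v ∈ T →
             ∃ λ g → g ∈ˡ edges G × v ∈ g × (∀ {u} → u ∈ T → u ∈ g → u ≡ v)
  critical {T} {v} (tr , min) v∈T with missed (min (T - v) (x∈p⇒p-x⊂p v∈T))
  ... | g , g∈G , none = g , g∈G , v∈g (All.lookup tr g∈G) , only
    where
    only : ∀ {u} → u ∈ T → u ∈ g → u ≡ v
    only {u} u∈T u∈g = decidable-stable (u FP.≟ v) λ u≢v → none (u , x∈p∧x≢y⇒x∈p-y u∈T u≢v , u∈g)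
    v∈g : Meets T g → v ∈ g
    v∈g (u , u∈T , u∈g) = subst (_∈ g) (only u∈T u∈g) u∈g

  defective⇒¬min : ∀ {e} → Defective e → ¬ MinTransversal G e
  defective⇒¬min (inj₁ (g , g∈G , none)) (tr , _) = none (All.lookup tr g∈G)
  defective⇒¬min (inj₂ (v , v∈e , none)) mt with critical mt v∈e
  ... | g , g∈G , _ , only = none (g , g∈G , λ (u , u∈e , u∈g , u≢v) → u≢v (only u∈e u∈g))

  ¬defective⇒min : ∀ {e} → ¬ Defective e → MinTransversal G e
  ¬defective⇒min {e} nd =
      All.tabulate (λ {g} g∈G → decidable-stable (meets? e g) (λ none → nd (inj₁ (g , g∈G , none))))
    , λ T′ (T′⊆e , v , v∈e , v∉T′) tr → nd (inj₂ (v , v∈e , λ (g , g∈G , none) →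
        let (u , u∈T′ , u∈g) = All.lookup tr g∈G
        in none (u , T′⊆e u∈T′ , u∈g , λ u≡v → v∉T′ (subst (_∈ T′) u≡v u∈T′))))

  -- A smaller transversal omits some `v` of `T` and so lies inside `T - v`. Testing single removals
  -- therefore suffices, which makes minimality decidable.
  irreducible⇒min : ∀ {T} → Transversal G T → ¬ (∃ λ v → v ∈ T × Transversal G (T - v)) →
                    MinTransversal G T
  irreducible⇒min tr none = tr , λ T′ (T′⊆T , v , v∈T , v∉T′) tr′ →
    none (v , v∈T , All.map (λ (u , u∈T′ , u∈g) →
      u , x∈p∧x≢y⇒x∈p-y (T′⊆T u∈T′) (λ { refl → v∉T′ u∈T′ }) , u∈g) tr′)

  reducible? : ∀ T → Dec (∃ λ v → v ∈ T × Transversal G (T - v))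
  reducible? T = FP.any? λ v → (v ∈? T) ×-dec transversal? (T - v)

  minTransversal? : Decidable (MinTransversal G)
  minTransversal? T with transversal? T | reducible? T
  ... | no ¬tr | _ = no (¬tr ∘ proj₁)
  ... | yes tr | yes (v , v∈T , tr′) = no λ (_ , min) → min (T - v) (x∈p⇒p-x⊂p v∈T) tr′
  ... | yes tr | no none = yes (irreducible⇒min tr none)

  minimize : ∀ {T} → Transversal G T → ∃ λ T′ → T′ ⊆ T × MinTransversal G T′
  minimize {T} = go (⊂-wellFounded T)
    where
    go : ∀ {T} → Acc _⊂_ T → Transversal G T → ∃ λ T′ → T′ ⊆ T × MinTransversal G T′
    go {T} (acc rec) tr with reducible? T
    ... | yes (v , v∈T , tr′) =
          let (T′ , T′⊆ , mt) = go (rec (x∈p⇒p-x⊂p v∈T)) tr′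
          in T′ , ⊆-trans T′⊆ (proj₁ (x∈p⇒p-x⊂p v∈T)) , mt
    ... | no none = T , ⊆-refl , irreducible⇒min tr none

  -- Membership in the set is an arbitrary predicate, because the formula
  -- describes the set only through the positions at which its vertices are written.
  Separates : (Fin m → Set) → Set
  Separates P = ¬ (∃ λ g → g ∈ˡ edges G × ¬ (∃ λ v → v ∈ g × P v)) ×
                ¬ (∃ λ h → h ∈ˡ edges H × ¬ (∃ λ v → v ∈ h × ¬ P v))

  -- The set is a transversal of `G`. Shrunk to a minimal one it would, by duality, be an edge of
  -- `H` inside `P`, which the second half of `Separates` forbids.
  separates⇒¬dual : ∀ {P} → Decidable P → Separates P → ¬ Dual G H
  separates⇒¬dual {P} P? (hitG , missH) dual with minimize tr
    where
    T₀ = Vec.tabulate (does ∘ P?)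
    ∈T₀ : ∀ {v} → P v → v ∈ T₀
    ∈T₀ {v} p = Vec.lookup⇒[]= v T₀ (trans (Vec.lookup∘tabulate _ v) (dec-true (P? v) p))
    tr : Transversal G T₀
    tr = All.tabulate λ {g} g∈G → decidable-stable (meets? T₀ g) λ none →
      hitG (g , g∈G , λ (v , v∈g , p) → none (v , ∈T₀ p , v∈g))
  ... | T′ , T′⊆ , mt = missH (T′ , from (dual T′) mt , λ (v , v∈T′ , ¬p) →
        contradiction (trans (≡-sym (Vec.[]=⇒lookup (T′⊆ v∈T′))) (trans (Vec.lookup∘tabulate _ v)
            (dec-false (P? v) ¬p))) λ ())

  _∈ˡ?_ : ∀ (S : Subset m) xs → Dec (S ∈ˡ xs)
  S ∈ˡ? xs = Any.any? (Vec.≡-dec _≟ᵇ_ S) xs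

  private
    contained-equal : ∀ {S T} → S ⊆ T → Transversal G S → MinTransversal G T → S ≡ T
    contained-equal {S} {T} S⊆T tr (_ , min) = ⊆-antisym S⊆T λ {v} v∈T →
      decidable-stable (v ∈? S) λ v∉S → min S (S⊆T , v , v∈T , v∉S) tr

  -- Comparable minimal transversals are equal, so one that is not an edge of `H` cannot contain an
  -- edge of `H` either.
  newTransversal : ¬ Dual G H → (∀ h → h ∈ˡ edges H → MinTransversal G h) →
                   ∃ λ T → MinTransversal G T × (∀ h → h ∈ˡ edges H → ¬ h ⊆ T)
  newTransversal ¬dual minH with anySubset? (λ T → minTransversal? T ×-dec ¬? (T ∈ˡ? edges H))
  ... | yes (T , mt , T∉H) = T , mt , λ h h∈H h⊆T →
        T∉H (subst (_∈ˡ edges H) (contained-equal h⊆T (proj₁ (minH h h∈H)) mt) h∈H)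
  ... | no none = ⊥-elim (¬dual λ S → mk⇔ (minH S)
        λ mt → decidable-stable (S ∈ˡ? edges H) λ S∉H → none (S , mt , S∉H))

  data Label : Set where
    one : Fin m → Label
    but : Subset m → Fin m → Label

  Excludes : Fin m → Label → Set
  Excludes v (one u)   = v ≡ u
  Excludes v (but S u) = v ∈ S × v ≢ u

  excludes? : ∀ v → Decidable (Excludes v)
  excludes? v (one u)   = v FP.≟ u
  excludes? v (but S u) = (v ∈? S) ×-dec ¬? (v FP.≟ u)

  Valid : Label → Set
  Valid (one _)   = ⊤
  Valid (but S u) = S ∈ˡ edges G × u ∈ S

  Excluded : List Label → Fin m → Set
  Excluded ls v = Any (Excludes v) ls

  excluded? : ∀ ls → Decidable (Excluded ls)
  excluded? ls v = Any.any? (excludes? v) ls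

  Live : List Label → Subset m → Set
  Live ls h = ¬ (∃ λ v → v ∈ h × Excluded ls v)

  live? : ∀ ls → Decidable (Live ls)
  live? ls h = ¬? (FP.any? λ v → (v ∈? h) ×-dec excluded? ls v)

  #live : List Label → ℕ
  #live ls = count (live? ls) (edges H)

  #with #without : List Label → Fin m → ℕ
  #with ls v = count (λ h → live? ls h ×-dec (v ∈? h)) (edges H)
  #without ls v = count (λ h → live? ls h ×-dec ¬? (v ∈? h)) (edges H)

  Frequent : List Label → Fin m → Set
  Frequent ls v = ¬ Excluded ls v × #without ls v ≤ #with ls v

  frequent? : ∀ ls → Decidable (Frequent ls)
  frequent? ls v = ¬? (excluded? ls v) ×-dec (#without ls v ≤? #with ls v)

  module _ {T} (T-min : MinTransversal G T) (T-new : ∀ h → h ∈ˡ edges H → ¬ h ⊆ T)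
           (minH : ∀ h → h ∈ˡ edges H → MinTransversal G h) where

    Safe : List Label → Set
    Safe ls = ∀ {v} → Excluded ls v → v ∉ T

    escapes : ∀ {h} → h ∈ˡ edges H → ∃ λ v → v ∈ h × v ∉ T
    escapes {h} h∈H = decidable-stable (FP.any? λ v → (v ∈? h) ×-dec ¬? (v ∈? T)) λ none →
      T-new h h∈H λ {v} v∈h → decidable-stable (v ∈? T) λ v∉T → none (v , v∈h , v∉T)

    step : ∀ ls → Safe ls →
           Separates (Frequent ls) ⊎
           (∃ λ ℓ → Valid ℓ × Safe (ℓ ∷ ls) × (∀ {k} → #live ls < 2 ^ suc k → #live (ℓ ∷ ls) < 2 ^ k))
    step ls safe with FP.any? (λ v → frequent? ls v ×-dec ¬? (v ∈? T))
    ... | yes (v , (v∉ex , fr) , v∉T) = inj₂ (one v , tt , safe′ , λ {k} bound →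
          ≤-<-trans (count-mono (live? (one v ∷ ls)) (λ h → live? ls h ×-dec ¬? (v ∈? h)) (edges H)
                      λ h _ lv → (λ (u , u∈h , exc) → lv (u , u∈h , there exc)) , λ v∈h →
                          lv (v , v∈h , here refl))
            (half-< {k = k} (subst (_< 2 ^ suc k)
               (trans (count-split (live? ls) (v ∈?_) (edges H)) (+-comm (#with ls v) (#without ls v)))
                   bound) fr))
      where
      safe′ : Safe (one v ∷ ls)
      safe′ (here refl) = v∉T
      safe′ (there exc) = safe exc
    ... | no F⊆T with All.all? (λ g → FP.any? λ v → (v ∈? g) ×-dec frequent? ls v) (edges G)
    -- All frequent vertices lie in `T`, while every edge of `H` has a vertex outside `T`; that
    -- vertex is not frequent.
    ...   | yes hit = inj₁ ((λ (g , g∈G , none) → none (All.lookup hit g∈G)) ,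
              λ (h , h∈H , none) → let (v , v∈h , v∉T) = escapes h∈H
                                 in none (v , v∈h , λ fr → F⊆T (v , fr , v∉T)))
    ...   | no ¬hit with find (All.¬All⇒Any¬ (λ g → FP.any? λ v → (v ∈? g) ×-dec frequent? ls v)
        (edges G) ¬hit)
    -- `g` has no frequent vertex, yet `T` meets it. The common vertex is not excluded, being in
    -- `T`, so it fails the majority condition.
    ...     | g , g∈G , none with All.lookup (proj₁ T-min) g∈G
    ...       | v , v∈T , v∈g with critical T-min v∈T
    ...         | S , S∈G , v∈S , only = inj₂ (but S v , (S∈G , v∈S) , safe′ , λ {k} bound →
          ≤-<-trans (count-mono (live? (but S v ∷ ls)) (λ h → live? ls h ×-dec (v ∈? h)) (edges H)
                      λ h h∈H lv → (λ (u , u∈h , exc) → lv (u , u∈h , there exc)) , through-v h h∈H lv)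
            (half-< {k = k} (subst (_< 2 ^ suc k) (count-split (live? ls) (v ∈?_) (edges H)) bound)
                (<⇒≤ infrequent)))
      where
      safe′ : Safe (but S v ∷ ls)
      safe′ (here (u∈S , u≢v)) u∈T = u≢v (only u∈T u∈S)
      safe′ (there exc) = safe exc
      infrequent : #with ls v < #without ls v
      infrequent = ≰⇒> λ fr → none (v , v∈g , (λ exc → safe exc v∈T) , fr)
      through-v : ∀ h → h ∈ˡ edges H → Live (but S v ∷ ls) h → v ∈ h
      through-v h h∈H lv with All.lookup (proj₁ (minH h h∈H)) S∈G
      ... | u , u∈h , u∈S with u FP.≟ v
      ...   | yes refl = u∈h
      ...   | no u≢v = ⊥-elim (lv (u , u∈h , here (u∈S , u≢v)))

    search : ∀ k ls → Safe ls → All Valid ls → #live ls < 2 ^ k →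
             ∃ λ ls′ → length ls′ ≤ k + length ls × All Valid ls′ × Separates (Frequent ls′)
    -- No edge is live, so the majority condition holds trivially and the frequent vertices are
    -- exactly those not excluded. They include `T`, and every edge of `H` has an excluded vertex.
    search zero ls safe valid bound = ls , ≤-refl , valid ,
      (λ (g , g∈G , none) → let (v , v∈T , v∈g) = All.lookup (proj₁ T-min) g∈G
                          in none (v , v∈g , (λ exc → safe exc v∈T) ,
                               ≤-trans (m≤n+m (#without ls v) (#with ls v))
                                   (≤-trans (≤-reflexive (≡-sym (count-split (live? ls) (v ∈?_) (edges H))))
                                  (≤-trans (≤-pred bound) z≤n)))) ,
      λ (h , h∈H , none) → dead h h∈H λ (v , v∈h , exc) → none (v , v∈h , λ fr → proj₁ fr exc)
      where
      dead : ∀ h → h ∈ˡ edges H → ¬ Live ls h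
      dead h h∈H lv = <⇒≱ bound (∈-length (∈-filter⁺ (live? ls) h∈H lv))
    search (suc k) ls safe valid bound with step ls safe
    ... | inj₁ sep = ls , m≤n+m _ _ , valid , sep
    ... | inj₂ (ℓ , ok , safe′ , halve) with search k (ℓ ∷ ls) safe′ (ok ∷ valid) (halve {k} bound)
    ...   | ls′ , len , valid′ , sep = ls′ , ≤-trans len (≤-reflexive (+-suc k _)) , valid′ , sep

  certificate : ∀ k → length (edges H) < 2 ^ k → ¬ Dual G H →
                (∀ h → h ∈ˡ edges H → MinTransversal G h) →
                ∃ λ ls → length ls ≤ k × All Valid ls × Separates (Frequent ls)
  certificate k bound ¬dual minH with newTransversal ¬dual minH
  ... | T , T-min , T-new with search T-min T-new minH k [] (λ ()) []
      (≤-<-trans (length-filter (live? []) (edges H)) bound)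
  ...   | ls , len , valid , sep = ls , ≤-trans len (≤-reflexive (+-identityʳ k)) , valid , sep

-- Semantics of formulas

Env : ∀ {s} → List (Fin s) → ℕ → Set
Env w k = Fin k → Fin (length w)

tally : ∀ n → (Fin n → Bool) → ℕ
tally n f = sum (map (λ p → if f p then 1 else 0) (allFin n))

-- A propositional reading of `eval`, in which witnesses can be projected and supplied; only the
-- counting clause keeps the Boolean tally.
Sat : ∀ {s k} (w : List (Fin s)) → Form s k → Env w k → Set
Sat w (sym a x) ρ = lookup w (ρ x) ≡ a
Sat w (eq x y)  ρ = ρ x ≡ ρ y
Sat w (lt x y)  ρ = toℕ (ρ x) < toℕ (ρ y)
Sat w (bit x y) ρ = bitAt (toℕ (ρ x)) (toℕ (ρ y)) ≡ true
Sat w (neg φ)   ρ = ¬ Sat w φ ρ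
Sat w (and φ ψ) ρ = Sat w φ ρ × Sat w ψ ρ
Sat w (ex φ)    ρ = ∃ λ p → Sat w φ (extend p ρ)
Sat w (cnt i φ) ρ = tally (length w) (λ p → eval w φ (extend p ρ)) ≡ toℕ (ρ i)

-- Generalised from `allFin` to an arbitrary `tabulate g`, since the tail of `allFin` is no longer
-- of the form `allFin`.
any-reflects : ∀ {n m} {P : Fin m → Set} (f : Fin m → Bool) (g : Fin n → Fin m) →
               (∀ i → Reflects (P i) (f i)) → Reflects (∃ λ i → P (g i)) (any f (tabulate g))
any-reflects {zero} f g r = ofⁿ λ ()
any-reflects {suc n} f g r with f (g F.zero) | r (g F.zero)
... | true  | ofʸ p = ofʸ (F.zero , p)
... | false | ofⁿ ¬p with any f (tabulate (g ∘ F.suc)) | any-reflects f (g ∘ F.suc) r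
...   | true  | ofʸ (i , p) = ofʸ (F.suc i , p)
...   | false | ofⁿ ¬q = ofⁿ λ { (F.zero , p) → ¬p p ; (F.suc i , p) → ¬q (i , p) }

sat-reflects : ∀ {s k} (w : List (Fin s)) (φ : Form s k) ρ → Reflects (Sat w φ ρ) (eval w φ ρ)
sat-reflects w (sym a x) ρ = proof (lookup w (ρ x) F.≟ a)
sat-reflects w (eq x y)  ρ = proof (ρ x F.≟ ρ y)
sat-reflects w (lt x y)  ρ = proof (ρ x F.<? ρ y)
sat-reflects w (bit x y) ρ with bitAt (toℕ (ρ x)) (toℕ (ρ y))
... | true = ofʸ refl
... | false = ofⁿ λ ()
sat-reflects w (neg φ)   ρ = ¬-reflects (sat-reflects w φ ρ)
sat-reflects w (and φ ψ) ρ = sat-reflects w φ ρ ×-reflects sat-reflects w ψ ρ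
sat-reflects w (ex φ)    ρ = any-reflects _ id λ p → sat-reflects w φ (extend p ρ)
sat-reflects w (cnt i φ) ρ = proof (tally (length w) (λ p → eval w φ (extend p ρ)) ≟ toℕ (ρ i))

sat? : ∀ {s k} (w : List (Fin s)) (φ : Form s k) ρ → Dec (Sat w φ ρ)
sat? w φ ρ = eval w φ ρ because sat-reflects w φ ρ

accepts⇔sat : ∀ {s} (w : List (Fin s)) (φ : Sentence s) → Accepts φ w ⇔ Sat w φ (λ ())
accepts⇔sat w φ = mk⇔ (λ e → invert (subst (Reflects _) e (sat-reflects w φ _)))
                      (dec-true (sat? w φ _))

ren : ∀ {s k l} → (Fin k → Fin l) → Form s k → Form s l
ren f (sym a x) = sym a (f x)
ren f (eq x y)  = eq (f x) (f y)
ren f (lt x y)  = lt (f x) (f y)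
ren f (bit x y) = bit (f x) (f y)
ren f (neg φ)   = neg (ren f φ)
ren f (and φ ψ) = and (ren f φ) (ren f ψ)
ren f (ex φ)    = ex (ren (F.lift 1 f) φ)
ren f (cnt i φ) = cnt (f i) (ren (F.lift 1 f) φ)

-- Stated for `eval` because the counting clause of `Sat` mentions Boolean values; `sat-ren` follows
-- by reflection.
eval-ren : ∀ {s k l} (w : List (Fin s)) (f : Fin k → Fin l) (φ : Form s k) {ρ σ} →
           (∀ x → σ (f x) ≡ ρ x) → eval w (ren f φ) σ ≡ eval w φ ρ
eval-ren-extend : ∀ {s k l} (w : List (Fin s)) (f : Fin k → Fin l) (φ : Form s (suc k)) {ρ σ} →
                  (∀ x → σ (f x) ≡ ρ x) →
                  ∀ p → eval w (ren (F.lift 1 f) φ) (extend p σ) ≡ eval w φ (extend p ρ)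
eval-ren w f (sym a x) e rewrite e x = refl
eval-ren w f (eq x y)  e rewrite e x | e y = refl
eval-ren w f (lt x y)  e rewrite e x | e y = refl
eval-ren w f (bit x y) e rewrite e x | e y = refl
eval-ren w f (neg φ)   e = cong not (eval-ren w f φ e)
eval-ren w f (and φ ψ) e = cong₂ _∧_ (eval-ren w f φ e) (eval-ren w f ψ e)
eval-ren w f (ex φ) {σ = σ} e = cong (foldr _∨_ false) (map-cong (eval-ren-extend w f φ {σ = σ} e)
    (allFin (length w)))
eval-ren w f (cnt i φ) {σ = σ} e = cong₂ (λ a b → does (sum a ≟ toℕ b))
  (map-cong (λ p → cong (λ b → if b then 1 else 0) (eval-ren-extend w f φ {σ = σ} e p))
      (allFin (length w))) (e i)
eval-ren-extend w f φ e p = eval-ren w (F.lift 1 f) φ λ { F.zero → refl ; (F.suc x) → e x }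

sat-ren : ∀ {s k l} (w : List (Fin s)) (f : Fin k → Fin l) (φ : Form s k) {ρ σ} →
          (∀ x → σ (f x) ≡ ρ x) → Sat w (ren f φ) σ ⇔ Sat w φ ρ
sat-ren w f φ {ρ} {σ} e = mk⇔
  (λ p → invert (subst (Reflects _) (trans (≡-sym (eval-ren w f φ e)) (dec-true (sat? w (ren f φ) σ) p))
      (sat-reflects w φ ρ)))
  (λ p → invert (subst (Reflects _) (trans (eval-ren w f φ e) (dec-true (sat? w φ ρ) p))
      (sat-reflects w (ren f φ) σ)))

-- Counts along the word

countBelow : (ℕ → Bool) → ℕ → ℕ
countBelow f zero    = 0
countBelow f (suc n) = countBelow f n + (if f n then 1 else 0)

countBelow-front : ∀ f n → countBelow f (suc n) ≡ (if f 0 then 1 else 0) + countBelow (f ∘ suc) n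
countBelow-front f zero = ≡-sym (+-identityʳ _)
countBelow-front f (suc n) rewrite countBelow-front f n = +-assoc (if f 0 then 1 else 0) _ _

countBelow-cong : ∀ {f g} n → (∀ i → i < n → f i ≡ g i) → countBelow f n ≡ countBelow g n
countBelow-cong zero e = refl
countBelow-cong (suc n) e = cong₂ (λ a b → a + (if b then 1 else 0))
  (countBelow-cong n λ i i<n → e i (m<n⇒m<1+n i<n)) (e n ≤-refl)

countBelow-≤ : ∀ f n → countBelow f n ≤ n
countBelow-≤ f zero = z≤n
countBelow-≤ f (suc n) with f n
... | true  = ≤-trans (≤-reflexive (+-comm _ 1)) (s≤s (countBelow-≤ f n))
... | false = ≤-trans (≤-reflexive (+-identityʳ _)) (m≤n⇒m≤1+n (countBelow-≤ f n))

countBelow-skip : ∀ f a k → (∀ i → i < k → f (a + i) ≡ false) → countBelow f (a + k) ≡ countBelow f a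
countBelow-skip f a zero off = cong (countBelow f) (+-identityʳ a)
countBelow-skip f a (suc k) off rewrite +-suc a k | off k ≤-refl =
  trans (+-identityʳ _) (countBelow-skip f a k λ i i<k → off i (m<n⇒m<1+n i<k))

-- Moves a tally from `Fin` to the natural numbers, where it can be cut at any position of the word.
tally-countBelow : ∀ n (f : Fin n → Bool) (g : ℕ → Bool) → (∀ p → f p ≡ g (toℕ p)) →
    tally n f ≡ countBelow g n
tally-countBelow n f g e =
  trans (cong sum (map-tabulate {n = n} id (λ p → if f p then 1 else 0))) (go f g e)
  where
  go : ∀ {n} (f : Fin n → Bool) (g : ℕ → Bool) → (∀ p → f p ≡ g (toℕ p)) →
       sum (tabulate (λ p → if f p then 1 else 0)) ≡ countBelow g n
  go {zero} f g e = refl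
  go {suc n} f g e = trans (cong₂ (λ b t → (if b then 1 else 0) + t) (e F.zero)
      (go (f ∘ F.suc) (g ∘ suc) (e ∘ F.suc)))
                           (≡-sym (countBelow-front g n))

-- Symbols and factors of a word

nth : ∀ {A : Set} → List A → ℕ → Maybe A
nth [] _ = nothing
nth (x ∷ xs) zero = just x
nth (x ∷ xs) (suc i) = nth xs i

nth-lookup : ∀ {A : Set} (xs : List A) p → nth xs (toℕ p) ≡ just (lookup xs p)
nth-lookup (x ∷ xs) F.zero = refl
nth-lookup (x ∷ xs) (F.suc p) = nth-lookup xs p

nth-++ˡ : ∀ {A : Set} (xs : List A) {ys i} → i < length xs → nth (xs ++ ys) i ≡ nth xs i
nth-++ˡ (x ∷ xs) {i = zero} _ = refl
nth-++ˡ (x ∷ xs) {i = suc i} (s≤s l) = nth-++ˡ xs l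

nth-++ʳ : ∀ {A : Set} (xs : List A) {ys} i → nth (xs ++ ys) (length xs + i) ≡ nth ys i
nth-++ʳ [] i = refl
nth-++ʳ (x ∷ xs) i = nth-++ʳ xs i

nth-< : ∀ {A : Set} (xs : List A) {i a} → nth xs i ≡ just a → i < length xs
nth-< (x ∷ xs) {zero} _ = s≤s z≤n
nth-< (x ∷ xs) {suc i} e = s≤s (nth-< xs e)

nth-defined : ∀ {A : Set} (xs : List A) {i} → i < length xs → ∃ λ a → nth xs i ≡ just a
nth-defined (x ∷ xs) {zero} _ = x , refl
nth-defined (x ∷ xs) {suc i} (s≤s l) = nth-defined xs l

nth-tabulate : ∀ {A : Set} {n} (f : Fin n → A) i → nth (tabulate f) (toℕ i) ≡ just (f i)
nth-tabulate f F.zero = refl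
nth-tabulate f (F.suc i) = nth-tabulate (f ∘ F.suc) i

nth-map : ∀ {A B : Set} (f : A → B) xs {i a} → nth xs i ≡ just a → nth (map f xs) i ≡ just (f a)
nth-map f (x ∷ xs) {zero} refl = refl
nth-map f (x ∷ xs) {suc i} e = nth-map f xs e

-- The factor `X` occurs in `w` at offset `i`. Pointwise agreement lets a factor be subdivided, or
-- carried to a longer word, without writing `w` as a concatenation again.
record Slice {A : Set} (w : List A) (i : ℕ) (X : List A) : Set where
  constructor mkSlice
  field agree : ∀ {k} → k < length X → nth w (i + k) ≡ nth X k
open Slice public

slice-++ˡ : ∀ {A : Set} {w : List A} {i} X {Y} → Slice w i (X ++ Y) → Slice w i X
slice-++ˡ X s .agree k< = trans (s .agree (≤-trans k<
    (≤-trans (m≤m+n _ _) (≤-reflexive (≡-sym (length-++ X)))))) (nth-++ˡ X k<)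

slice-++ʳ : ∀ {A : Set} {w : List A} {i} X {Y} → Slice w i (X ++ Y) → Slice w (i + length X) Y
slice-++ʳ {w = w} {i} X s .agree {k} k< =
  trans (cong (nth w) (+-assoc i (length X) k))
  (trans (s .agree (≤-trans (+-monoʳ-< (length X) k<) (≤-reflexive (≡-sym (length-++ X))))) (nth-++ʳ X k))

slice-at : ∀ {A : Set} {w : List A} {i X k a} → Slice w i X → nth X k ≡ just a → nth w (i + k) ≡ just a
slice-at {X = X} s e = trans (s .agree (nth-< X e)) e

-- Vertex codes

true-ext : ∀ {s t} → (s ≡ true → t ≡ true) → (t ≡ true → s ≡ true) → s ≡ t
true-ext {true} f _ = ≡-sym (f refl)
true-ext {false} {true} _ g = g refl
true-ext {false} {false} _ _ = refl

n≤2^⌈log₂n⌉ : ∀ n → n ≤ 2 ^ ⌈log₂ n ⌉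
n≤2^⌈log₂n⌉ = <-rec _ λ where
  zero _ → z≤n
  (suc zero) _ → s≤s z≤n
  n@(suc (suc k)) rec →
    let h = ⌈ n /2⌉
        log-n : ⌈log₂ n ⌉ ≡ suc ⌈log₂ h ⌉
        log-n = trans (≡-sym (m+[n∸m]≡n (⌈log₂⌉-mono-≤ {2} {n} (s≤s (s≤s z≤n)))))
                      (cong suc (≡-sym (⌈log₂⌈n/2⌉⌉≡⌈log₂n⌉∸1 n)))
        h≤ = rec (⌈n/2⌉<n k)
    in ≤-trans (≤-reflexive (≡-sym (⌊n/2⌋+⌈n/2⌉≡n n)))
       (≤-trans (+-mono-≤ (≤-trans (⌊n/2⌋≤⌈n/2⌉ n) h≤) (≤-trans h≤ (≤-reflexive (≡-sym (+-identityʳ _)))))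
                (≤-reflexive (cong (2 ^_) (≡-sym log-n))))

parity-split : ∀ x → x ≡ (if isOdd x then 1 else 0) + (⌊ x /2⌋ + ⌊ x /2⌋)
parity-split zero = refl
parity-split (suc zero) = refl
parity-split (suc (suc x)) with isOdd x | parity-split x
... | true  | e = cong suc (trans (cong suc e) (cong suc (≡-sym (+-suc _ _))))
... | false | e = cong suc (trans (cong suc e) (≡-sym (+-suc _ _)))

half-bound : ∀ {x L} → x < 2 ^ suc L → ⌊ x /2⌋ < 2 ^ L
half-bound {x} {L} x< = *-cancelˡ-< 2 ⌊ x /2⌋ (2 ^ L) (≤-<-trans
  (≤-trans (≤-reflexive (cong (⌊ x /2⌋ +_) (+-identityʳ _)))
    (≤-trans (m≤n+m _ (if isOdd x then 1 else 0)) (≤-reflexive (≡-sym (parity-split x))))) x<)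

-- Parity and half determine a number. This serves twice: for vertex codes and for positions read
-- from the guess.
bits-injective : ∀ L {x y} → x < 2 ^ L → y < 2 ^ L → (∀ j → j < L → bitAt x j ≡ bitAt y j) → x ≡ y
bits-injective zero x< y< _ = trans (n<1⇒n≡0 x<) (≡-sym (n<1⇒n≡0 y<))
bits-injective (suc L) {x} {y} x< y< agree =
  trans (parity-split x) (trans
    (cong₂ (λ b h → (if b then 1 else 0) + (h + h)) (agree 0 (s≤s z≤n))
      (bits-injective L (half-bound {x} {L} x<) (half-bound {y} {L} y<) λ j j<L → agree (suc j) (s≤s j<L)))
    (≡-sym (parity-split y)))

countBelow-full : ∀ f a k → (∀ i → i < k → f (a + i) ≡ true) → countBelow f (a + k) ≡ countBelow f a + k
countBelow-full f a zero on = trans (cong (countBelow f) (+-identityʳ a)) (≡-sym (+-identityʳ _))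
countBelow-full f a (suc k) on rewrite +-suc a k | on k ≤-refl =
  trans (cong (_+ 1) (countBelow-full f a k λ i i<k → on i (m<n⇒m<1+n i<k)))
      (trans (+-assoc (countBelow f a) k 1) (cong (countBelow f a +_) (+-comm k 1)))

countBelow-none : ∀ f n → (∀ i → i < n → f i ≡ false) → countBelow f n ≡ 0
countBelow-none f n off = countBelow-skip f 0 n off

countBelow-cut : ∀ f {m n} → m ≤ n → (∀ i → m ≤ i → f i ≡ false) → countBelow f n ≡ countBelow f m
countBelow-cut f {m} {n} m≤n off =
  trans (cong (countBelow f) (≡-sym (m+[n∸m]≡n m≤n))) (countBelow-skip f m (n ∸ m) λ i _ →
      off (m + i) (m≤m+n m i))

between-count : ∀ {a p n} → a < p → p ≤ n → countBelow (λ y → does (a <? y) ∧ does (y <? p)) n ≡ p ∸ suc a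
between-count {a} {p} {n} a<p p≤n =
  trans (countBelow-cut f p≤n λ i p≤i → trans (cong (does (a <? i) ∧_) (dec-false (i <? p) (≤⇒≯ p≤i)))
      (∧-false _))
  (trans (cong (countBelow f) (≡-sym (m+[n∸m]≡n a<p)))
  (trans (countBelow-full f (suc a) (p ∸ suc a) λ i i< →
      cong₂ _∧_ (dec-true (a <? suc a + i) (s≤s (m≤m+n a i)))
            (dec-true (suc a + i <? p) (≤-trans (+-monoʳ-< (suc a) i<) (≤-reflexive (m+[n∸m]≡n a<p)))))
         (cong (_+ (p ∸ suc a)) (countBelow-none f (suc a) λ i i≤a → cong (_∧ does (i <? p))
             (dec-false (a <? i) (≤⇒≯ (≤-pred i≤a)))))))
  where
  f : ℕ → Bool
  f y = does (a <? y) ∧ does (y <? p)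
  ∧-false : ∀ b → b ∧ false ≡ false
  ∧-false true = refl
  ∧-false false = refl

-- Formulas for occurrences of vertices

Formula : ℕ → Set
Formula = Form 8

pattern v0 = F.zero
pattern v1 = F.suc F.zero
pattern v2 = F.suc (F.suc F.zero)
pattern v3 = F.suc (F.suc (F.suc F.zero))

comma semicolon hash mark₀ mark₁ : Fin 8
comma = # 2
semicolon = # 3
hash = # 4
mark₀ = # 6
mark₁ = # 7

wk : ∀ {k} → Fin k → Fin (suc k)
wk = F.suc

or : ∀ {k} → Formula k → Formula k → Formula k
or φ ψ = neg (and (neg φ) (neg ψ))

digit inner : ∀ {k} → Fin k → Formula k
digit x = or (sym (# 0) x) (sym (# 1) x)
inner x = or (digit x) (sym comma x)

run : (∀ {k} → Fin k → Formula k) → ∀ {k} → Fin k → Fin k → Formula k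
run χ x y = and (lt x y) (neg (ex (and (lt (wk x) v0) (and (lt v0 (wk y)) (neg (χ v0))))))

inCode inEdge : ∀ {k} → Fin k → Fin k → Formula k
inCode x y = and (digit x) (and (sym comma y) (run digit x y))
inEdge x y = and (sym comma x) (and (sym semicolon y) (run inner x y))

-- Two gaps are compared through a common count of the positions strictly inside them, which avoids
-- expressing arithmetic on positions by `bit`.
sameDistance : ∀ {k} → Fin k → Fin k → Fin k → Fin k → Formula k
sameDistance a p b q = ex (and (cnt v0 (and (lt (wk (wk a)) v0) (lt v0 (wk (wk p)))))
                               (cnt v0 (and (lt (wk (wk b)) v0) (lt v0 (wk (wk q))))))

-- Inclusion of the sets of one-bits; `sameVertex` uses it in both directions. Digits are aligned by
-- their distance to the closing comma, which is sound because all codes have the same width.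
codeIn : ∀ {k} → Fin k → Fin k → Formula k
codeIn p q = neg (ex (ex (and (inCode v1 (wk (wk p))) (and (inCode v0 (wk (wk q)))
  (and (sameDistance v1 (wk (wk p)) v0 (wk (wk q))) (and (sym (# 1) v1) (neg (sym (# 1) v0))))))))

sameVertex : ∀ {k} → Fin k → Fin k → Formula k
sameVertex p q = and (and (sym comma p) (sym comma q)) (and (codeIn p q) (codeIn q p))

Digit Inner : Fin 8 → Set
Digit a = a ≡ # 0 ⊎ a ≡ # 1
Inner a = Digit a ⊎ a ≡ comma

up : List (Fin 5) → List (Fin 8)
up = map (F._↑ˡ 3)

bitSym-digit : ∀ b → Digit (bitSym b F.↑ˡ 3)
bitSym-digit false = inj₁ refl
bitSym-digit true = inj₂ refl

module Positions (w : List (Fin 8)) where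

  Pos : Set
  Pos = Fin (length w)

  At : ℕ → Fin 8 → Set
  At i a = nth w i ≡ just a

  at-lookup : ∀ {p : Pos} {a} → lookup w p ≡ a → At (toℕ p) a
  at-lookup {p} refl = nth-lookup w p

  at-unique : ∀ {i a b} → At i a → At i b → a ≡ b
  at-unique e e′ = just-injective (trans (≡-sym e) e′)

  lookup-at : ∀ {p : Pos} {a} → At (toℕ p) a → lookup w p ≡ a
  lookup-at {p} e = at-unique (nth-lookup w p) e

  position : ∀ {i} → i < length w → ∃ λ (p : Pos) → toℕ p ≡ i
  position i< = fromℕ< i< , FP.toℕ-fromℕ< i<

  position-at : ∀ {i a} → At i a → ∃ λ (p : Pos) → toℕ p ≡ i × lookup w p ≡ a
  position-at {i} {a} e with position (nth-< w e)
  ... | p , refl = p , refl , lookup-at e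

  at-move : ∀ {i j a} → i ≡ j → At i a → At j a
  at-move refl e = e

  or⇔ : ∀ {k} (φ ψ : Formula k) ρ → Sat w (or φ ψ) ρ ⇔ (Sat w φ ρ ⊎ Sat w ψ ρ)
  or⇔ φ ψ ρ = mk⇔
    (λ s → decidable-stable (sat? w φ ρ ⊎-dec sat? w ψ ρ) λ n → s (n ∘ inj₁ , n ∘ inj₂))
    λ { (inj₁ a) (¬a , _) → ¬a a ; (inj₂ b) (_ , ¬b) → ¬b b }

  digit⇔ : ∀ {k} (x : Fin k) ρ → Sat w (digit x) ρ ⇔ Digit (lookup w (ρ x))
  digit⇔ x ρ = or⇔ (sym (# 0) x) (sym (# 1) x) ρ

  inner⇔ : ∀ {k} (x : Fin k) ρ → Sat w (inner x) ρ ⇔ Inner (lookup w (ρ x))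
  inner⇔ x ρ = mk⇔
    (λ s → Sum.map₁ (to (digit⇔ x ρ)) (to (or⇔ (digit x) (sym comma x) ρ) s))
    (λ c → from (or⇔ (digit x) (sym comma x) ρ) (Sum.map₁ (from (digit⇔ x ρ)) c))

  Run : (Fin 8 → Set) → ℕ → ℕ → Set
  Run P i j = i < j × (∀ {k c} → i < k → k < j → At k c → P c)

  run⇔ : ∀ (χ : ∀ {k} → Fin k → Formula k) {P} → (∀ {k} (x : Fin k) ρ → Sat w (χ x) ρ ⇔ P (lookup w (ρ x))) →
         ∀ {k} (x y : Fin k) ρ → Sat w (run χ x y) ρ ⇔ Run P (toℕ (ρ x)) (toℕ (ρ y))
  run⇔ χ {P} χ⇔ x y ρ = mk⇔
    (λ (x<y , none) → x<y , λ {k} {c} x<k k<y at → aux x<k k<y at none)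
    λ (x<y , all) → x<y , λ (z , x<z , z<y , ¬χ) →
        ¬χ (from (χ⇔ v0 (extend z ρ)) (all x<z z<y (nth-lookup w z)))
    where
    aux : ∀ {k c} → toℕ (ρ x) < k → k < toℕ (ρ y) → At k c →
        ¬ Sat w (ex (and (lt (wk x) v0) (and (lt v0 (wk y)) (neg (χ v0))))) ρ → P c
    aux x<k k<y at none with position-at at
    ... | z , refl , refl = to (χ⇔ v0 (extend z ρ)) (decidable-stable (sat? w (χ v0) (extend z ρ)) λ ¬χ →
        none (z , x<k , k<y , ¬χ))

  InCode InEdge : Pos → Pos → Set
  InCode a p = Digit (lookup w a) × lookup w p ≡ comma × Run Digit (toℕ a) (toℕ p)
  InEdge p s = lookup w p ≡ comma × lookup w s ≡ semicolon × Run Inner (toℕ p) (toℕ s)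

  inCode⇔ : ∀ {k} (x y : Fin k) ρ → Sat w (inCode x y) ρ ⇔ InCode (ρ x) (ρ y)
  inCode⇔ x y ρ = mk⇔
    (λ (d , c , r) → to (digit⇔ x ρ) d , c , to (run⇔ digit digit⇔ x y ρ) r)
    (λ (d , c , r) → from (digit⇔ x ρ) d , c , from (run⇔ digit digit⇔ x y ρ) r)

  inEdge⇔ : ∀ {k} (x y : Fin k) ρ → Sat w (inEdge x y) ρ ⇔ InEdge (ρ x) (ρ y)
  inEdge⇔ x y ρ = mk⇔
    (λ (c , s , r) → c , s , to (run⇔ inner inner⇔ x y ρ) r)
    (λ (c , s , r) → c , s , from (run⇔ inner inner⇔ x y ρ) r)

  -- A run of `P` symbols cannot enter from the left of such a position; at 0 the condition is
  -- vacuous.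
  Boundary : (Fin 8 → Set) → ℕ → Set
  Boundary P i = ∀ {k a} → suc k ≡ i → At k a → ¬ P a

  run-start : ∀ {P st} {p q : Pos} → Boundary P st → st ≤ toℕ q → P (lookup w p) → Run P (toℕ p)
      (toℕ q) → st ≤ toℕ p
  run-start {st = zero} _ _ _ _ = z≤n
  run-start {st = suc k} {p} {q} bd k<q Pp (p<q , r) with suc k ≤? toℕ p
  ... | yes st≤p = st≤p
  ... | no st≰p with m≤n⇒m<n∨m≡n (≤-pred (≰⇒> st≰p))
  ...   | inj₂ refl = ⊥-elim (bd refl (nth-lookup w p) Pp)
  ...   | inj₁ p<k = let (c , e) = nth-defined w (<-trans k<q (FP.toℕ<n q)) in ⊥-elim
                           (bd refl e (r p<k k<q e))

  -- The earlier of two distinct ends would lie strictly inside the other run, where only `P`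
  -- symbols occur.
  run-end-unique : ∀ {P a} → ¬ P a → ∀ {i} {p q : Pos} → lookup w p ≡ a → lookup w q ≡ a →
                   Run P i (toℕ p) → Run P i (toℕ q) → p ≡ q
  run-end-unique ¬P {p = p} {q} ep eq′ (i<p , rp) (i<q , rq) with <-cmp (toℕ p) (toℕ q)
  ... | tri< p<q _ _ = ⊥-elim (¬P (rq i<p p<q (at-lookup ep)))
  ... | tri≈ _ p≡q _ = FP.toℕ-injective p≡q
  ... | tri> _ _ q<p = ⊥-elim (¬P (rp i<q q<p (at-lookup eq′)))

  inCode-unique : ∀ {a p q} → InCode a p → InCode a q → p ≡ q
  inCode-unique (_ , ep , rp) (_ , eq′ , rq) = run-end-unique (λ { (inj₁ ()) ; (inj₂ ()) }) ep eq′ rp rq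

  inEdge-unique : ∀ {p s t} → InEdge p s → InEdge p t → s ≡ t
  inEdge-unique (_ , es , rs) (_ , et , rt) = run-end-unique
      (λ { (inj₁ (inj₁ ())) ; (inj₁ (inj₂ ())) ; (inj₂ ()) }) es et rs rt

  sameDistance⇔ : ∀ {k} (a p b q : Fin k) ρ → toℕ (ρ a) < toℕ (ρ p) → toℕ (ρ b) < toℕ (ρ q) →
    Sat w (sameDistance a p b q) ρ ⇔ (toℕ (ρ p) ∸ suc (toℕ (ρ a)) ≡ toℕ (ρ q) ∸ suc (toℕ (ρ b)))
  sameDistance⇔ a p b q ρ a<p b<q = mk⇔
    (λ (i , e , e′) → trans (≡-sym (tally≡ (ρ a) (ρ p) a<p))
        (trans e (trans (≡-sym e′) (tally≡ (ρ b) (ρ q) b<q))))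
    λ e → let (i , i≡) = position (≤-<-trans (m∸n≤m (toℕ (ρ p)) (suc (toℕ (ρ a)))) (FP.toℕ<n (ρ p)))
          in i , trans (tally≡ (ρ a) (ρ p) a<p) (≡-sym i≡) , trans (tally≡ (ρ b) (ρ q) b<q)
              (trans (≡-sym e) (≡-sym i≡))
    where
    tally≡ : ∀ (a p : Pos) → toℕ a < toℕ p → tally (length w) (λ y → does (a F.<? y) ∧ does (y F.<? p)) ≡
        toℕ p ∸ suc (toℕ a)
    tally≡ a p a<p = trans (tally-countBelow (length w) _ (λ y → does (toℕ a <? y) ∧ does (y <? toℕ p))
        λ _ → refl)
                           (between-count a<p (<⇒≤ (FP.toℕ<n p)))

  CodeIn : Pos → Pos → Set
  CodeIn p q = ∀ {a b} → InCode a p → InCode b q → toℕ p ∸ suc (toℕ a) ≡ toℕ q ∸ suc (toℕ b) →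
               lookup w a ≡ # 1 → lookup w b ≡ # 1

  codeIn⇔ : ∀ {k} (x y : Fin k) ρ → Sat w (codeIn x y) ρ ⇔ CodeIn (ρ x) (ρ y)
  codeIn⇔ x y ρ = mk⇔
    (λ s {a} {b} ca cb d e → decidable-stable (lookup w b F.≟ _) λ ne →
      let σ = extend b (extend a ρ) in
      s (a , b , from (inCode⇔ v1 (wk (wk x)) σ) ca , from (inCode⇔ v0 (wk (wk y)) σ) cb ,
         from (sameDistance⇔ v1 (wk (wk x)) v0 (wk (wk y)) σ (proj₁ (proj₂ (proj₂ ca)))
             (proj₁ (proj₂ (proj₂ cb)))) d , e , ne))
    bwd
    where
    bwd : CodeIn (ρ x) (ρ y) → Sat w (codeIn x y) ρ
    bwd c (a , b , ca , cb , d , e , ne) = ne (c ca′ cb′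
        (to (sameDistance⇔ v1 (wk (wk x)) v0 (wk (wk y)) σ (proj₁ (proj₂ (proj₂ ca′)))
            (proj₁ (proj₂ (proj₂ cb′)))) d) e)
      where
      σ = extend b (extend a ρ)
      ca′ = to (inCode⇔ v1 (wk (wk x)) σ) ca
      cb′ = to (inCode⇔ v0 (wk (wk y)) σ) cb

  module Codes (m : ℕ) where

    width : ℕ
    width = ⌈log₂ suc m ⌉

    code : Fin m → List (Fin 8)
    code v = up (encVertex v)

    length-code : ∀ v → length (code v) ≡ width
    length-code v = trans (length-map _ (encVertex v)) (trans (length-map _ (allFin width))
        (length-tabulate id))

    nth-code : ∀ v {j} → j < width → nth (code v) j ≡ just (bitSym (bitAt (toℕ v) j) F.↑ˡ 3)
    nth-code v {j} j< = subst (λ i → nth (code v) i ≡ just (bitSym (bitAt (toℕ v) i) F.↑ˡ 3))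
        (FP.toℕ-fromℕ< j<)
      (nth-map _ (encVertex v) (nth-map _ (allFin width) (nth-tabulate id (fromℕ< j<))))

    -- An occurrence of a vertex is addressed by the comma closing its code. The boundary keeps
    -- further digits from joining on the left, so the digits related to this comma by `inCode` are
    -- exactly the code.
    record VertexAt (p : ℕ) (v : Fin m) : Set where
      constructor vertexAt
      field
        start : ℕ
        end   : p ≡ start + width
        slice : Slice w start (code v ++ comma ∷ [])
        first : Boundary Digit start

      bit-at : ∀ {j} → j < width → At (start + j) (bitSym (bitAt (toℕ v) j) F.↑ˡ 3)
      bit-at {j} j< = slice-at (slice-++ˡ (code v) slice) (nth-code v j<)

      comma-at : At p comma
      comma-at = at-move (trans (+-identityʳ _) (trans (cong (start +_) (length-code v)) (≡-sym end)))
                   (slice-at {X = comma ∷ []} (slice-++ʳ (code v) slice) refl)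

      digit-pos : ∀ {a p′ : Pos} → toℕ p′ ≡ p → InCode a p′ → ∃ λ j → j < width × toℕ a ≡ start + j
      digit-pos {a} {p′} refl (d , _ , r) =
        toℕ a ∸ start , +-cancelˡ-< start _ _ (subst₂ _<_ (≡-sym (m+[n∸m]≡n s≤a)) end (proj₁ r)) ,
            ≡-sym (m+[n∸m]≡n s≤a)
        where
        s≤a : start ≤ toℕ a
        s≤a = run-start {q = p′} first (≤-trans (m≤m+n start width) (≤-reflexive (≡-sym end))) d r

      digit-in : ∀ {a p′ : Pos} {j} → toℕ p′ ≡ p → j < width → toℕ a ≡ start + j → InCode a p′
      digit-in {a} {p′} {j} refl j< ea =
        subst Digit (≡-sym (lookup-at {a} (at-move (≡-sym ea) (bit-at j<))))
            (bitSym-digit (bitAt (toℕ v) j)) ,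
        lookup-at comma-at ,
        subst₂ _<_ (≡-sym ea) (≡-sym end) (+-monoʳ-< start j<) ,
        λ {k} a<k k<p e →
          let s≤k = ≤-trans (m≤m+n start j) (≤-trans (≤-reflexive (≡-sym ea)) (<⇒≤ a<k))
              k∸s< = +-cancelˡ-< start _ _ (subst₂ _<_ (≡-sym (m+[n∸m]≡n s≤k)) end k<p)
          in subst Digit (at-unique (at-move (m+[n∸m]≡n s≤k) (bit-at k∸s<)) e)
              (bitSym-digit (bitAt (toℕ v) (k ∸ start)))

    v<2^width : ∀ (v : Fin m) → toℕ v < 2 ^ width
    v<2^width v = ≤-trans (m≤n⇒m≤1+n (FP.toℕ<n v)) (n≤2^⌈log₂n⌉ (suc m))

    open VertexAt

    -- Between the digit of bit `j` and the comma stand `width ∸ suc j` symbols. Below the width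
    -- this number determines `j`, so equal distances mean equal bit indices.
    codeIn-bits : ∀ {p q v u} → VertexAt (toℕ p) v → VertexAt (toℕ q) u →
      CodeIn p q ⇔ (∀ {j} → j < width → bitAt (toℕ v) j ≡ true → bitAt (toℕ u) j ≡ true)
    codeIn-bits {p} {q} {v} {u} V U = mk⇔
      (λ c {j} j< e →
         let (a , a≡ , la) = position-at (bit-at V j<)
             (b , b≡ , lb) = position-at (bit-at U j<)
         in one-true (trans (≡-sym lb) (c (digit-in V refl j< a≡) (digit-in U refl j< b≡)
              (trans (distance V a≡) (≡-sym (distance U b≡))) (trans la (cong (λ t → bitSym t F.↑ˡ 3) e)))))
      λ bits {a} {b} ca cb d e →
         let (j , j< , a≡) = digit-pos V refl ca
             (i , i< , b≡) = digit-pos U refl cb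
             i≡j : j ≡ i
             i≡j = ∸suc-injective j< i< (trans (≡-sym (distance V a≡)) (trans d (distance U b≡)))
             bv = one-true (trans (at-unique (at-move (≡-sym a≡) (bit-at V j<)) (nth-lookup w a)) e)
             bu = bits j< bv
         in trans (at-unique (nth-lookup w b) (at-move (≡-sym b≡) (bit-at U i<)))
                  (cong (λ t → bitSym t F.↑ˡ 3) (subst (λ n → bitAt (toℕ u) n ≡ true) i≡j bu))
      where
      one-true : ∀ {t} → bitSym t F.↑ˡ 3 ≡ # 1 → t ≡ true
      one-true {true} _ = refl
      one-true {false} ()
      distance : ∀ {p v a j} (V : VertexAt p v) → a ≡ start V + j → p ∸ suc a ≡ width ∸ suc j
      distance {a = a} {j} V refl = trans (cong₂ _∸_ (end V) (≡-sym (+-suc (start V) j)))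
          ([m+n]∸[m+o]≡n∸o (start V) width (suc j))
      ∸suc-injective : ∀ {n i j} → i < n → j < n → n ∸ suc i ≡ n ∸ suc j → i ≡ j
      ∸suc-injective {n} i< j< e = suc-injective
          (trans (≡-sym (m∸[m∸n]≡n i<)) (trans (cong (n ∸_) e) (m∸[m∸n]≡n j<)))

    sameVertex⇔ : ∀ {k} (x y : Fin k) ρ {v u} → VertexAt (toℕ (ρ x)) v → VertexAt (toℕ (ρ y)) u →
                  Sat w (sameVertex x y) ρ ⇔ (v ≡ u)
    sameVertex⇔ x y ρ {v} {u} V U = mk⇔
      (λ (_ , c , c′) → FP.toℕ-injective (bits-injective width (v<2^width v) (v<2^width u) λ j j< →
          true-ext (to (codeIn-bits V U) (to (codeIn⇔ x y ρ) c) j<)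
              (to (codeIn-bits U V) (to (codeIn⇔ y x ρ) c′) j<)))
      λ { refl → (lookup-at (comma-at V) , lookup-at (comma-at U)) ,
                 from (codeIn⇔ x y ρ) (from (codeIn-bits V U) λ _ e → e) ,
                 from (codeIn⇔ y x ρ) (from (codeIn-bits U V) λ _ e → e) }

-- Edge codes

All-nth : ∀ {A : Set} {P : A → Set} {xs} → All P xs → ∀ {k a} → nth xs k ≡ just a → P a
All-nth (p ∷ _) {zero} refl = p
All-nth (_ ∷ ps) {suc k} e = All-nth ps e

-- One parsing argument for three levels: vertices in an edge, edges in a hypergraph, blocks in a
-- guess. `B` is what must hold at the left end of a block, and `advance` carries it across.
module Blocks {A : Set} (w : List (Fin 8)) (f : A → List (Fin 8)) (B : ℕ → Set)
              (advance : ∀ {x i} → B i → Slice w i (f x) → B (i + length (f x))) where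

  find-block : ∀ xs {i} → B i → Slice w i (concatMap f xs) → ∀ {k} → k < length (concatMap f xs) →
    ∃ λ x → x ∈ˡ xs × ∃ λ st → ∃ λ j → B st × Slice w st (f x) × j < length (f x) × i + k ≡ st + j
  find-block (x ∷ xs) {i} b s {k} k< with k <? length (f x)
  ... | yes k<x = x , here refl , i , k , b , slice-++ˡ (f x) s , k<x , refl
  ... | no k≮x =
    let x≤k = ≮⇒≥ k≮x
        (x′ , x∈ , st , j , b′ , s′ , j< , e) = find-block xs (advance b (slice-++ˡ (f x) s))
            (slice-++ʳ (f x) s)
            {k ∸ length (f x)} (+-cancelˡ-< (length (f x)) _ _ (subst₂ _<_ (≡-sym (m+[n∸m]≡n x≤k))
                (length-++ (f x)) k<))
    in x′ , there x∈ , st , j , b′ , s′ , j< ,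
       trans (cong (i +_) (≡-sym (m+[n∸m]≡n x≤k))) (trans (≡-sym (+-assoc i (length (f x)) _)) e)

  block-of : ∀ {x} xs {i} → x ∈ˡ xs → B i → Slice w i (concatMap f xs) →
    ∃ λ st → B st × Slice w st (f x) × i ≤ st × st + length (f x) ≤ i + length (concatMap f xs)
  block-of (x ∷ xs) {i} (here refl) b s = i , b , slice-++ˡ (f x) s , ≤-refl ,
    +-monoʳ-≤ i (≤-trans (m≤m+n _ _) (≤-reflexive (≡-sym (length-++ (f x)))))
  block-of (x ∷ xs) {i} (there x∈) b s with block-of xs x∈ (advance b (slice-++ˡ (f x) s)) (slice-++ʳ (f x) s)
  ... | st , b′ , s′ , i≤ , ≤end = st , b′ , s′ , ≤-trans (m≤m+n i _) i≤ ,
    ≤-trans ≤end (≤-reflexive (trans (+-assoc i _ _) (cong (i +_) (≡-sym (length-++ (f x))))))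

  -- Keeps the blocks that follow, because the cells of a guess block are delimited only by the next
  -- header or the end of the word.
  block-split : ∀ {x} xs {i} → x ∈ˡ xs → B i → Slice w i (concatMap f xs) →
    ∃ λ st → ∃ λ rest → Slice w st (f x) × Slice w (st + length (f x)) (concatMap f rest) ×
      st + length (f x) + length (concatMap f rest) ≡ i + length (concatMap f xs)
  block-split (x ∷ xs) {i} (here refl) b s = i , xs , slice-++ˡ (f x) s , slice-++ʳ (f x) s ,
    trans (+-assoc i _ _) (cong (i +_) (≡-sym (length-++ (f x))))
  block-split (x ∷ xs) {i} (there x∈) b s =
    let (st , rest , s₁ , s₂ , e) = block-split xs x∈ (advance b (slice-++ˡ (f x) s)) (slice-++ʳ (f x) s)
    in st , rest , s₁ , s₂ , trans e (trans (+-assoc i _ _) (cong (i +_) (≡-sym (length-++ (f x)))))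

module Edges (w : List (Fin 8)) (m : ℕ) where
  open Positions w
  open Codes m

  boundary-after : ∀ {P a i} X → Slice w i (X ++ a ∷ []) → ¬ P a → Boundary P (i + length (X ++ a ∷ []))
  boundary-after {a = a} {i} X s ¬P {k} e at p = ¬P (subst _ (at-unique at at′) p)
    where
    k≡ : k ≡ i + length X + 0
    k≡ = suc-injective (trans e (trans (cong (i +_) (trans (length-++ X) (+-comm _ 1)))
        (trans (+-suc i _) (cong suc (≡-sym (+-identityʳ _))))))
    at′ : At k a
    at′ = at-move (≡-sym k≡) (slice-at {X = a ∷ []} (slice-++ʳ X s) refl)

  vertexBlock : Subset m → Fin m → List (Fin 8)
  vertexBlock S v = up (if Vec.lookup S v then encVertex v ++ # 2 ∷ [] else [])

  edgeCode : Subset m → List (Fin 8)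
  edgeCode S = concatMap (vertexBlock S) (allFin m)

  up-encEdge : ∀ S → up (encEdge S) ≡ edgeCode S
  up-encEdge S = map-concatMap (F._↑ˡ 3) _ (allFin m)

  vertexBlock-view : ∀ S v → vertexBlock S v ≡ [] ⊎ (v ∈ S × vertexBlock S v ≡ code v ++ comma ∷ [])
  vertexBlock-view S v with Vec.lookup S v in e
  ... | true = inj₂ (Vec.lookup⇒[]= v S e , map-++ _ (encVertex v) _)
  ... | false = inj₁ refl

  vertexBlock-∈ : ∀ {S v} → v ∈ S → vertexBlock S v ≡ code v ++ comma ∷ []
  vertexBlock-∈ {S} {v} v∈S rewrite Vec.[]=⇒lookup v∈S = map-++ _ (encVertex v) _

  code-digits : ∀ v → All Digit (code v)
  code-digits v = All.map⁺ (All.map⁺ (All.tabulate λ {j} _ → bitSym-digit (bitAt (toℕ v) (toℕ j))))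

  edgeCode-inner : ∀ S → All Inner (edgeCode S)
  edgeCode-inner S = All.concat⁺ (All.map⁺ (All.tabulate {xs = allFin m} λ {v} _ → block v))
    where
    block : ∀ v → All Inner (vertexBlock S v)
    block v with vertexBlock S v | vertexBlock-view S v
    ... | _ | inj₁ refl = []
    ... | _ | inj₂ (_ , refl) = All.++⁺ (All.map inj₁ (code-digits v)) (inj₂ refl ∷ [])

  vertexBlock-boundary : ∀ S v {i} → Boundary Digit i → Slice w i (vertexBlock S v) → Boundary Digit
      (i + length (vertexBlock S v))
  vertexBlock-boundary S v {i} b s with vertexBlock S v | vertexBlock-view S v
  ... | _ | inj₁ refl = λ e → b (trans e (+-identityʳ i))
  ... | _ | inj₂ (_ , refl) = boundary-after {P = Digit} (code v) s λ { (inj₁ ()) ; (inj₂ ()) }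

  module VertexBlocks (S : Subset m) = Blocks w (vertexBlock S) (Boundary Digit)
      (λ {v} → vertexBlock-boundary S v)

  comma-in-edge : ∀ {S i k} → Boundary Digit i → Slice w i (edgeCode S) → k < length (edgeCode S) →
      At (i + k) comma →
                  ∃ λ v → v ∈ S × VertexAt (i + k) v
  comma-in-edge {S} {i} {k} b s k< at with VertexBlocks.find-block S (allFin m) b s k<
  ... | v , _ , st , j , b′ , s′ , j< , e with vertexBlock S v | vertexBlock-view S v
  ...   | _ | inj₁ refl = ⊥-elim (case-< j<)
    where
    case-< : ¬ (j < 0)
    case-< ()
  ...   | _ | inj₂ (v∈S , refl) = v , v∈S , vertexAt st (trans e (cong (st +_) j≡)) s′ b′
    where
    j≡ : j ≡ width
    j≡ with j <? width
    -- Below the width stands a digit of the code, so the comma can only be the last symbol of the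
    -- block.
    ... | yes j<w = ⊥-elim (not-digit (subst Digit
        (at-unique (slice-at (slice-++ˡ (code v) s′) (nth-code v j<w)) (at-move e at))
            (bitSym-digit (bitAt (toℕ v) j))))
      where
      not-digit : ¬ Digit comma
      not-digit (inj₁ ())
      not-digit (inj₂ ())
    ... | no j≮w = ≤-antisym (≤-pred (≤-trans j<
        (≤-reflexive (trans (length-++ (code v)) (trans (cong (_+ 1) (length-code v))
            (+-comm width 1)))))) (≮⇒≥ j≮w)

  vertex-in-edge : ∀ {S i v} → Boundary Digit i → Slice w i (edgeCode S) → v ∈ S →
                   ∃ λ k → k < length (edgeCode S) × VertexAt (i + k) v
  vertex-in-edge {S} {i} {v} b s v∈S with VertexBlocks.block-of S (allFin m) (∈-allFin v) b s
  ... | st , b′ , s′ , i≤ , ≤end rewrite vertexBlock-∈ v∈S =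
    st + width ∸ i ,
    +-cancelˡ-< i _ _ (≤-trans (≤-reflexive (cong suc (m+[n∸m]≡n i≤st+w))) (≤-trans (≤-reflexive len) ≤end)) ,
    vertexAt st (m+[n∸m]≡n i≤st+w) s′ b′
    where
    i≤st+w : i ≤ st + width
    i≤st+w = ≤-trans i≤ (m≤m+n st width)
    len : suc (st + width) ≡ st + length (code v ++ comma ∷ [])
    len = trans (≡-sym (+-suc st width)) (cong (st +_)
        (≡-sym (trans (length-++ (code v)) (trans (cong (_+ 1) (length-code v)) (+-comm width 1)))))

  edgeBlock : Subset m → List (Fin 8)
  edgeBlock S = edgeCode S ++ semicolon ∷ []

  -- The analogue of `VertexAt` one level up: the boundary against `Inner` keeps commas of an
  -- earlier edge from being joined to this semicolon.
  record SemicolonAt (p : ℕ) (S : Subset m) : Set where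
    constructor semicolonAt
    field
      start : ℕ
      end   : p ≡ start + length (edgeCode S)
      slice : Slice w start (edgeBlock S)
      first : Boundary Inner start

    semicolon-at : At p semicolon
    semicolon-at = at-move (trans (+-identityʳ _) (≡-sym end))
        (slice-at {X = semicolon ∷ []} (slice-++ʳ (edgeCode S) slice) refl)

    in-edge-vertex : ∀ {q p′ : Pos} → toℕ p′ ≡ p → InEdge q p′ → ∃ λ v → v ∈ S × VertexAt (toℕ q) v
    in-edge-vertex {q} {p′} refl (c , _ , r) =
      let (v , v∈S , V) = comma-in-edge {S} {start} {toℕ q ∸ start} (λ e at → first e at ∘ inj₁)
            (slice-++ˡ (edgeCode S) slice)
                      (+-cancelˡ-< start _ _ (subst₂ _<_ (≡-sym q≡) end (proj₁ r)))
                          (at-move (≡-sym q≡) (at-lookup c))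
      in v , v∈S , subst (λ n → VertexAt n v) q≡ V
      where
      s≤q : start ≤ toℕ q
      s≤q = run-start {q = p′} first (≤-trans (m≤m+n start _) (≤-reflexive (≡-sym end))) (inj₂ c) r
      q≡ : start + (toℕ q ∸ start) ≡ toℕ q
      q≡ = m+[n∸m]≡n s≤q

    vertex-in : ∀ {p′ : Pos} {v} → toℕ p′ ≡ p → v ∈ S → ∃ λ q → InEdge q p′ × VertexAt (toℕ q) v
    vertex-in {p′} {v} refl v∈S with vertex-in-edge {S} (λ e at → first e at ∘ inj₁)
        (slice-++ˡ (edgeCode S) slice) v∈S
    ... | k , k< , V with position-at (VertexAt.comma-at V)
    ...   | q , q≡ , lq = q ,
      (lq , lookup-at semicolon-at ,
        subst₂ _<_ (≡-sym q≡) (≡-sym end) (+-monoʳ-< start k<) ,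
        λ {i} q<i i<p at →
          let s≤i = ≤-trans (m≤m+n start k) (≤-trans (≤-reflexive (≡-sym q≡)) (<⇒≤ q<i))
              i∸s< = +-cancelˡ-< start _ _ (subst₂ _<_ (≡-sym (m+[n∸m]≡n s≤i)) end i<p)
              (a , e) = nth-defined (edgeCode S) i∸s<
          in subst Inner (at-unique (at-move (m+[n∸m]≡n s≤i) (slice-at (slice-++ˡ (edgeCode S) slice) e))
              at) (All-nth (edgeCode-inner S) e)) ,
      subst (λ n → VertexAt n v) (≡-sym q≡) V

  edgesCode : List (Subset m) → List (Fin 8)
  edgesCode = concatMap edgeBlock

  up-encHyp : ∀ (G : Hypergraph m) → up (encHyp G) ≡ edgesCode (edges G)
  up-encHyp G = trans (map-concatMap (F._↑ˡ 3) _ (edges G))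
    (concatMap-cong (λ S → trans (map-++ _ (encEdge S) _) (cong (_++ semicolon ∷ []) (up-encEdge S)))
        (edges G))

  ¬inner-semicolon : ¬ Inner semicolon
  ¬inner-semicolon (inj₁ (inj₁ ()))
  ¬inner-semicolon (inj₁ (inj₂ ()))
  ¬inner-semicolon (inj₂ ())

  module EdgeBlocks = Blocks w edgeBlock (Boundary Inner)
    (λ {S} _ s → boundary-after {P = Inner} (edgeCode S) s ¬inner-semicolon)

  length-edgeBlock : ∀ S → length (edgeBlock S) ≡ suc (length (edgeCode S))
  length-edgeBlock S = trans (length-++ (edgeCode S)) (+-comm _ 1)

  module _ (es : List (Subset m)) {i} (b : Boundary Inner i) (s : Slice w i (edgesCode es)) where

    comma-in-edges : ∀ {k} → k < length (edgesCode es) → At (i + k) comma → ∃ λ v → VertexAt (i + k) v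
    comma-in-edges {k} k< at with EdgeBlocks.find-block es b s k<
    ... | S , _ , st , j , b′ , s′ , j< , e with j <? length (edgeCode S)
    ...   | yes j<S = let (v , _ , V) = comma-in-edge {S} (λ e at → b′ e at ∘ inj₁)
                            (slice-++ˡ (edgeCode S) s′) j<S (at-move e at)
                      in v , subst (λ n → VertexAt n v) (≡-sym e) V
    ...   | no j≮S = ⊥-elim (contra (at-unique (at-move e at)
        (at-move (trans (+-identityʳ _) (cong (st +_) (≡-sym j≡)))
                       (slice-at {X = semicolon ∷ []} (slice-++ʳ (edgeCode S) s′) refl))))
      where
      j≡ : j ≡ length (edgeCode S)
      j≡ = ≤-antisym (≤-pred (≤-trans j< (≤-reflexive (length-edgeBlock S)))) (≮⇒≥ j≮S)
      contra : ¬ comma ≡ semicolon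
      contra ()

    semicolon-in-edges : ∀ {k} → k < length (edgesCode es) → At (i + k) semicolon → ∃ λ S → S ∈ˡ es ×
        SemicolonAt (i + k) S
    semicolon-in-edges {k} k< at with EdgeBlocks.find-block es b s k<
    ... | S , S∈ , st , j , b′ , s′ , j< , e with j <? length (edgeCode S)
    ...   | yes j<S = let (a , e′) = nth-defined (edgeCode S) j<S
                      in ⊥-elim (¬inner-semicolon
                          (subst Inner (at-unique (slice-at (slice-++ˡ (edgeCode S) s′) e′)
                              (at-move e at)) (All-nth (edgeCode-inner S) e′)))
    ...   | no j≮S = S , S∈ , semicolonAt st (trans e (cong (st +_) j≡)) s′ b′
      where
      j≡ : j ≡ length (edgeCode S)
      j≡ = ≤-antisym (≤-pred (≤-trans j< (≤-reflexive (length-edgeBlock S)))) (≮⇒≥ j≮S)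

    edge-in-edges : ∀ {S} → S ∈ˡ es → ∃ λ k → k < length (edgesCode es) × SemicolonAt (i + k) S
    edge-in-edges {S} S∈ with EdgeBlocks.block-of es S∈ b s
    ... | st , b′ , s′ , i≤ , ≤end = st + l ∸ i ,
      +-cancelˡ-< i _ _ (≤-trans (≤-reflexive (trans (cong suc (m+[n∸m]≡n i≤st+l))
          (trans (≡-sym (+-suc st l)) (cong (st +_) (≡-sym (length-edgeBlock S)))))) ≤end) ,
      semicolonAt st (m+[n∸m]≡n i≤st+l) s′ b′
      where
      l = length (edgeCode S)
      i≤st+l : i ≤ st + l
      i≤st+l = ≤-trans i≤ (m≤m+n st l)

  -- An edge block holds exactly one semicolon, its last symbol, so counting semicolons counts
  -- edges. This ties the counting quantifier to the list counts in the certificate.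
  count-edges : ∀ (f : ℕ → Bool) {Q : Subset m → Set} (Q? : Decidable Q) es {i} → Boundary Inner i →
      Slice w i (edgesCode es) →
    (∀ {p S} → i ≤ p → SemicolonAt p S → S ∈ˡ es → f p ≡ does (Q? S)) →
    (∀ {p a} → At p a → ¬ a ≡ semicolon → f p ≡ false) →
    countBelow f (i + length (edgesCode es)) ≡ countBelow f i + count Q? es
  count-edges f Q? [] {i} b s hit miss = trans (cong (countBelow f) (+-identityʳ i)) (≡-sym (+-identityʳ _))
  count-edges f Q? (S ∷ es) {i} b s hit miss = begin
    countBelow f (i + length (edgeBlock S ++ edgesCode es))
      ≡⟨ cong (countBelow f) (trans (cong (i +_) (length-++ (edgeBlock S))) (≡-sym (+-assoc i _ _))) ⟩
    countBelow f (i + length (edgeBlock S) + length (edgesCode es))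
      ≡⟨ count-edges f Q? es (boundary-after {P = Inner} (edgeCode S) sS ¬inner-semicolon)
          (slice-++ʳ (edgeBlock S) s)
           (λ i≤p P S∈ → hit (≤-trans (m≤m+n i _) i≤p) P (there S∈)) miss ⟩
    countBelow f (i + length (edgeBlock S)) + count Q? es
      ≡⟨ cong (_+ count Q? es) block ⟩
    countBelow f i + (if does (Q? S) then 1 else 0) + count Q? es
      ≡⟨ +-assoc (countBelow f i) _ _ ⟩
    countBelow f i + ((if does (Q? S) then 1 else 0) + count Q? es)
      ≡⟨ cong (countBelow f i +_) (≡-sym (count-∷)) ⟩
    countBelow f i + count Q? (S ∷ es) ∎
    where
    open ≡-Reasoning
    sS = slice-++ˡ (edgeBlock S) s
    l = length (edgeCode S)
    count-∷ : count Q? (S ∷ es) ≡ (if does (Q? S) then 1 else 0) + count Q? es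
    count-∷ with does (Q? S)
    ... | true = refl
    ... | false = refl
    block : countBelow f (i + length (edgeBlock S)) ≡ countBelow f i + (if does (Q? S) then 1 else 0)
    block rewrite length-edgeBlock S | +-suc i l =
      cong₂ (λ c t → c + (if t then 1 else 0))
        (countBelow-skip f i l λ k k< → let (a , e) = nth-defined (edgeCode S) k<
           in miss (slice-at (slice-++ˡ (edgeCode S) sS) e) λ a≡ → ¬inner-semicolon
               (subst Inner a≡ (All-nth (edgeCode-inner S) e)))
        (hit (m≤m+n i l) (semicolonAt i refl sS b) (here refl))

-- The checking formula

⇔-trans : {A B C : Set} → A ⇔ B → B ⇔ C → A ⇔ C
⇔-trans e f = mk⇔ (to f ∘ to e) (from e ∘ from f)

-- A record, so that formulas are recovered by unification although Sat computes.
record Means {k} (w : List (Fin 8)) (φ : Formula k) (ρ : Env w k) (P : Set) : Set where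
  constructor means
  field sat⇔ : Sat w φ ρ ⇔ P
open Means public

means-neg : ∀ {w k} {φ : Formula k} {ρ P} → Means w φ ρ P → Means w (neg φ) ρ (¬ P)
means-neg (means e) = means (mk⇔ (_∘ from e) (_∘ to e))

means-⇔ : ∀ {w k} {φ : Formula k} {ρ P Q} → Means w φ ρ P → P ⇔ Q → Means w φ ρ Q
means-⇔ (means e) f = means (⇔-trans e f)

module _ {w : List (Fin 8)} {k} {φ ψ : Formula k} {ρ : Env w k} {P Q : Set} where

  means-and : Means w φ ρ P → Means w ψ ρ Q → Means w (and φ ψ) ρ (P × Q)
  means-and (means e) (means f) = means (mk⇔ (Product.map (to e) (to f)) (Product.map (from e) (from f)))

  means-or : Means w φ ρ P → Means w ψ ρ Q → Means w (or φ ψ) ρ (P ⊎ Q)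
  means-or (means e) (means f) = means (mk⇔
    (Sum.map (to e) (to f) ∘ to (Positions.or⇔ w φ ψ ρ))
    (from (Positions.or⇔ w φ ψ ρ) ∘ Sum.map (from e) (from f)))

inG inH : ∀ {k} → Fin k → Formula k
inG s = and (sym semicolon s) (ex (and (sym hash v0) (lt (wk s) v0)))
inH s = and (sym semicolon s) (ex (and (sym hash v0) (lt v0 (wk s))))

-- A vertex is quantified through the commas closing its occurrences. It may have many, so formulas
-- compare vertices by `sameVertex` and never by equality of positions.
exV exG exH : ∀ {k} → Formula (suc k) → Formula k
exV φ = ex (and (sym comma v0) φ)
exG φ = ex (and (inG v0) φ)
exH φ = ex (and (inH v0) φ)

mem : ∀ {k} → Fin k → Fin k → Formula k
mem x s = ex (and (inEdge v0 (wk s)) (sameVertex (wk x) v0))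

defective : ∀ {k} → Fin k → Formula k
defective s = or
  (exG (neg (exV (and (mem v0 (wk (wk s))) (mem v0 v1)))))
  (exV (and (mem v0 (wk s)) (neg (exG (neg (exV
    (and (mem v0 (wk (wk (wk s)))) (and (mem v0 v1) (neg (sameVertex v0 v2))))))))))

next : ∀ {k} → Fin k → Fin k → Formula k
next x y = and (lt x y) (neg (ex (and (lt (wk x) v0) (lt v0 (wk y)))))

-- A block is addressed by the final zero of its header `true true false`; the payload starts right
-- after it.
blockStart : ∀ {k} → Fin k → Formula k
blockStart d = and (sym mark₀ d) (ex (and (next v0 (wk d)) (and (sym mark₁ v0)
                 (ex (and (next v0 v1) (sym mark₁ v0))))))

-- Each payload bit yields exactly one zero, so the bit index is the number of zeros between the
-- header and `u`; the value of the bit is then `marked u`. The search for a later header includes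
-- `u` itself, so the zero of the next header is no cell.
bitCell : ∀ {k} → Fin k → Fin k → Fin k → Formula k
bitCell d u j = and (and (lt d u) (sym mark₀ u))
  (and (neg (ex (and (lt (wk d) v0) (and (neg (lt (wk u) v0)) (blockStart v0)))))
       (cnt j (and (and (lt (wk d) v0) (lt v0 (wk u))) (sym mark₀ v0))))

marked : ∀ {k} → Fin k → Formula k
marked u = ex (and (next v0 (wk u)) (sym mark₁ v0))

iff : ∀ {k} → Formula k → Formula k → Formula k
iff φ ψ = and (neg (and φ (neg ψ))) (neg (and ψ (neg φ)))

-- The number in the block is never computed: its cells are compared with the bits of the candidate
-- `q`. Bits of `q` beyond the last cell remain unchecked.
decodes : ∀ {k} → Fin k → Fin k → Formula k
decodes d q = and (blockStart d) (neg (ex (ex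
  (and (bitCell (wk (wk d)) v1 v0) (neg (iff (bit (wk (wk q)) v0) (marked v1)))))))

-- `sameVertex` requires a comma at `q` and `inCode` a digit, so at most one disjunct can apply and
-- the symbol at `q` tells the kind of label.
excludedBy : ∀ {k} → Fin k → Fin k → Formula k
excludedBy q x = or (sameVertex x q) (ex (ex
  (and (inCode (wk (wk q)) v1) (and (inEdge v1 v0)
      (and (mem (wk (wk x)) v0) (neg (sameVertex (wk (wk x)) v1)))))))

excluded : ∀ {k} → Fin k → Formula k
excluded x = ex (and (ex (decodes v0 v1)) (excludedBy v0 (wk x)))

live : ∀ {k} → Fin k → Formula k
live s = neg (exV (and (mem v0 (wk s)) (excluded v0)))

opaque
  -- The two bound positions hold the numbers of live edges with and without the vertex. Opaque, so
  -- that `notDual frequent` does not unfold to the whole reading of the guess; only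
  -- `means-frequent` looks inside.
  frequent : Formula 1
  frequent = and (neg (excluded v0)) (ex (ex
    (and (cnt v1 (and (inH v0) (and (live v0) (mem v3 v0))))
    (and (cnt v0 (and (inH v0) (and (live v0) (neg (mem v3 v0)))))
         (neg (lt v1 v0))))))

-- Closing ψ under sameVertex makes its truth value depend on the vertex only.
chosen : Formula 1 → ∀ {k} → Fin k → Formula k
chosen ψ x = ex (and (sameVertex (wk x) v0) (ren (λ _ → v0) ψ))

separates : Formula 1 → Formula 0
separates ψ = and (neg (exG (neg (exV (and (mem v0 v1) (chosen ψ v0))))))
                  (neg (exH (neg (exV (and (mem v0 v1) (neg (chosen ψ v0)))))))

notDual : Formula 1 → Sentence 8
notDual ψ = or (exH (defective v0)) (separates ψ)

-- The tail is constrained only in its alphabet, which keeps digits, commas, semicolons and hashes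
-- out of it. An empty tail serves to locate labels, an arbitrary guess gives soundness, an honest
-- guess completeness.
module Instance {m : ℕ} (G H : Hypergraph m) (wf : WellFormed G) (w tail : List (Fin 8))
                (w≡ : w ≡ up (encInst G H) ++ tail) (tail-symbols : All (λ a → 5 ≤ toℕ a) tail) where

  open Positions w public
  open Codes m public
  open Edges w m public
  open Duality G H

  codeG codeH : List (Fin 8)
  codeG = edgesCode (edges G)
  codeH = edgesCode (edges H)

  hashPos n : ℕ
  hashPos = length codeG
  n = suc hashPos + length codeH

  up-encInst : up (encInst G H) ≡ codeG ++ hash ∷ codeH
  up-encInst = trans (map-++ _ (encHyp G) _) (cong₂ (λ a b → a ++ hash ∷ b) (up-encHyp G) (up-encHyp H))

  layout : w ≡ codeG ++ hash ∷ codeH ++ tail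
  layout = trans w≡ (trans (cong (_++ tail) up-encInst) (++-assoc codeG _ _))

  length-instance : length (encInst G H) ≡ n
  length-instance = trans (≡-sym (length-map (F._↑ˡ 3) (encInst G H))) (trans
    (cong length up-encInst)
    (trans (length-++ codeG) (+-suc _ _)))

  length-w : length w ≡ n + length tail
  length-w = trans (cong length w≡) (trans (length-++ (up (encInst G H)))
      (cong (_+ length tail) (trans (length-map _ (encInst G H)) length-instance)))

  whole : Slice w 0 (codeG ++ hash ∷ codeH ++ tail)
  whole = subst (Slice w 0) layout (mkSlice λ _ → refl)

  sliceG : Slice w 0 codeG
  sliceG = slice-++ˡ codeG whole

  hash-at : At hashPos hash
  hash-at = at-move (+-identityʳ hashPos) (slice-at {X = hash ∷ []}
      (slice-++ˡ (hash ∷ []) (slice-++ʳ codeG whole)) refl)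

  slice-rest : Slice w (suc hashPos) (codeH ++ tail)
  slice-rest = subst (λ i → Slice w i (codeH ++ tail)) (+-comm hashPos 1)
      (slice-++ʳ (hash ∷ []) (slice-++ʳ codeG whole))

  sliceH : Slice w (suc hashPos) codeH
  sliceH = slice-++ˡ codeH slice-rest

  slice-tail : Slice w n tail
  slice-tail = slice-++ʳ codeH slice-rest

  boundaryG : Boundary Inner 0
  boundaryG ()

  boundaryH : Boundary Inner (suc hashPos)
  boundaryH refl at i with at-unique at hash-at
  boundaryH refl at (inj₁ (inj₁ ())) | refl
  boundaryH refl at (inj₁ (inj₂ ())) | refl
  boundaryH refl at (inj₂ ()) | refl

  data Zone (i : ℕ) : Set where
    zoneG    : i < hashPos → Zone i
    zoneHash : i ≡ hashPos → Zone i
    zoneH    : ∀ {k} → k < length codeH → i ≡ suc hashPos + k → Zone i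
    zoneTail : ∀ {k} → k < length tail → i ≡ n + k → Zone i

  zone : ∀ {i a} → At i a → Zone i
  zone {i} at with <-cmp i hashPos
  ... | tri< i< _ _ = zoneG i<
  ... | tri≈ _ i≡ _ = zoneHash i≡
  ... | tri> _ _ i> with i ∸ suc hashPos <? length codeH
  ...   | yes k< = zoneH k< (≡-sym (m+[n∸m]≡n i>))
  ...   | no k≮ = zoneTail (+-cancelˡ-< n _ _ (subst₂ _<_ (≡-sym (m+[n∸m]≡n n≤i)) length-w (nth-< w at)))
      (≡-sym (m+[n∸m]≡n n≤i))
    where
    n≤i : n ≤ i
    n≤i = ≤-trans (+-monoʳ-≤ (suc hashPos) (≮⇒≥ k≮)) (≤-reflexive (m+[n∸m]≡n i>))

  tail-symbol : ∀ {k a} → k < length tail → At (n + k) a → 5 ≤ toℕ a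
  tail-symbol k< at with nth-defined tail k<
  ... | b , e = subst (λ c → 5 ≤ toℕ c) (at-unique (slice-at {X = tail} slice-tail e) at)
      (All-nth tail-symbols e)

  edges-symbols : ∀ es → All (λ a → toℕ a ≤ 3) (edgesCode es)
  edges-symbols es = All.concat⁺ (All.map⁺ (All.tabulate {xs = es} λ {S} _ →
      All.++⁺ (All.map inner-≤ (edgeCode-inner S)) (≤-refl ∷ [])))
    where
    inner-≤ : ∀ {a} → Inner a → toℕ a ≤ 3
    inner-≤ (inj₁ (inj₁ refl)) = z≤n
    inner-≤ (inj₁ (inj₂ refl)) = s≤s z≤n
    inner-≤ (inj₂ refl) = s≤s (s≤s z≤n)

  edges-symbol : ∀ es {i k a} → Slice w i (edgesCode es) → k < length (edgesCode es) → At (i + k) a →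
      toℕ a ≤ 3
  edges-symbol es s k< at with nth-defined (edgesCode es) k<
  ... | b , e = subst (λ c → toℕ c ≤ 3) (at-unique (slice-at s e) at) (All-nth (edges-symbols es) e)

  hash-unique : ∀ {i} → At i hash → i ≡ hashPos
  hash-unique at with zone at
  ... | zoneG i< = contradiction (edges-symbol (edges G) sliceG i< at) λ { (s≤s (s≤s (s≤s ()))) }
  ... | zoneHash e = e
  ... | zoneH k< refl = contradiction (edges-symbol (edges H) sliceH k< at) λ { (s≤s (s≤s (s≤s ()))) }
  ... | zoneTail k< refl = contradiction (tail-symbol k< at) λ { (s≤s (s≤s (s≤s (s≤s ())))) }

  comma-vertex : ∀ {i} → At i comma → ∃ λ v → VertexAt i v
  comma-vertex at with zone at
  ... | zoneG i< = comma-in-edges (edges G) boundaryG sliceG i< at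
  ... | zoneHash refl = contradiction (at-unique at hash-at) λ ()
  ... | zoneH k< refl = comma-in-edges (edges H) boundaryH sliceH k< at
  ... | zoneTail k< refl = contradiction (tail-symbol k< at) λ { (s≤s (s≤s ())) }

  semicolonG : ∀ {i} → At i semicolon → i < hashPos → ∃ λ S → S ∈ˡ edges G × SemicolonAt i S
  semicolonG at i< = semicolon-in-edges (edges G) boundaryG sliceG i< at

  semicolonH : ∀ {i} → At i semicolon → hashPos < i → ∃ λ S → S ∈ˡ edges H × SemicolonAt i S
  semicolonH at i> with zone at
  ... | zoneG i< = contradiction i< (<-asym i>)
  ... | zoneHash refl = contradiction i> (<-irrefl refl)
  ... | zoneH k< refl = semicolon-in-edges (edges H) boundaryH sliceH k< at
  ... | zoneTail k< refl = contradiction (tail-symbol k< at) λ { (s≤s (s≤s (s≤s ()))) }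

  abstract
    -- Quantifying over commas reaches every vertex because each one lies in an edge of `G` and is
    -- thus written somewhere.
    vertex-position : ∀ v → ∃ λ (p : Pos) → VertexAt (toℕ p) v
    vertex-position v =
      let (S , S∈ , v∈S) = proj₂ (proj₂ wf) v
          (i , i< , at) = edge-in-edges (edges G) boundaryG sliceG S∈
          (s , s≡ , _) = position-at (SemicolonAt.semicolon-at at)
          (p , _ , V) = SemicolonAt.vertex-in at s≡ v∈S
      in p , V

  module _ {k} {φ : Formula (suc k)} {ρ : Env w k} where

    means-exG : {Q : Subset m → Set} →
                (∀ p S → S ∈ˡ edges G → SemicolonAt (toℕ p) S → Means w φ (extend p ρ) (Q S)) →
                Means w (exG φ) ρ (∃ λ S → S ∈ˡ edges G × Q S)
    means-exG {Q} φ≙ = means (mk⇔ fwd bwd)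
      where
      fwd : Sat w (exG φ) ρ → ∃ λ S → S ∈ˡ edges G × Q S
      fwd (p , (ep , h , eh , p<h) , sat) =
        let (S , S∈ , at) = semicolonG (at-lookup ep) (subst (toℕ p <_) (hash-unique (at-lookup eh)) p<h)
        in S , S∈ , to (sat⇔ (φ≙ p S S∈ at)) sat
      bwd : (∃ λ S → S ∈ˡ edges G × Q S) → Sat w (exG φ) ρ
      bwd (S , S∈ , q) =
        let (i , i< , at) = edge-in-edges (edges G) boundaryG sliceG S∈
            (h , h≡ , eh) = position-at hash-at
            (p , p≡ , ep) = position-at (SemicolonAt.semicolon-at at)
        in p , (ep , h , eh , subst₂ _<_ (≡-sym p≡) (≡-sym h≡) i<) ,
           from (sat⇔ (φ≙ p S S∈ (subst (λ i → SemicolonAt i S) (≡-sym p≡) at))) q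

    means-exH : {Q : Subset m → Set} →
                (∀ p S → S ∈ˡ edges H → SemicolonAt (toℕ p) S → Means w φ (extend p ρ) (Q S)) →
                Means w (exH φ) ρ (∃ λ S → S ∈ˡ edges H × Q S)
    means-exH {Q} φ≙ = means (mk⇔ fwd bwd)
      where
      fwd : Sat w (exH φ) ρ → ∃ λ S → S ∈ˡ edges H × Q S
      fwd (p , (ep , h , eh , h<p) , sat) =
        let (S , S∈ , at) = semicolonH (at-lookup ep) (subst (_< toℕ p) (hash-unique (at-lookup eh)) h<p)
        in S , S∈ , to (sat⇔ (φ≙ p S S∈ at)) sat
      bwd : (∃ λ S → S ∈ˡ edges H × Q S) → Sat w (exH φ) ρ
      bwd (S , S∈ , q) =
        let (i , i< , at) = edge-in-edges (edges H) boundaryH sliceH S∈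
            (h , h≡ , eh) = position-at hash-at
            (p , p≡ , ep) = position-at (SemicolonAt.semicolon-at at)
        in p , (ep , h , eh , subst₂ _<_ (≡-sym h≡) (≡-sym p≡) (m≤m+n (suc hashPos) i)) ,
           from (sat⇔ (φ≙ p S S∈ (subst (λ i → SemicolonAt i S) (≡-sym p≡) at))) q

    means-exV : {Q : Fin m → Set} → (∀ p v → VertexAt (toℕ p) v → Means w φ (extend p ρ) (Q v)) →
                Means w (exV φ) ρ (∃ Q)
    means-exV {Q} φ≙ = means (mk⇔ fwd bwd)
      where
      fwd : Sat w (exV φ) ρ → ∃ Q
      fwd (p , ep , sat) = let (v , at) = comma-vertex (at-lookup ep) in v , to (sat⇔ (φ≙ p v at)) sat
      bwd : ∃ Q → Sat w (exV φ) ρ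
      bwd (v , q) = let (p , V) = vertex-position v in p , lookup-at (VertexAt.comma-at V) ,
                          from (sat⇔ (φ≙ p v V)) q

  means-same : ∀ {k} {x y : Fin k} {ρ : Env w k} {v u} → VertexAt (toℕ (ρ x)) v → VertexAt (toℕ (ρ y)) u →
               Means w (sameVertex x y) ρ (v ≡ u)
  means-same {x = x} {y} {ρ} V U = means (sameVertex⇔ x y ρ V U)

  means-mem : ∀ {k} (x s : Fin k) {ρ : Env w k} {v S} → VertexAt (toℕ (ρ x)) v → SemicolonAt (toℕ (ρ s)) S →
              Means w (mem x s) ρ (v ∈ S)
  means-mem x s {ρ} {v} {S} V E = means (mk⇔ fwd bwd)
    where
    fwd : Sat w (mem x s) ρ → v ∈ S
    fwd (p , ie , sv) =
      let (u , u∈S , U) = SemicolonAt.in-edge-vertex E refl (to (inEdge⇔ v0 (wk s) (extend p ρ)) ie)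
      in subst (_∈ S) (≡-sym (to (sameVertex⇔ (wk x) v0 (extend p ρ) V U) sv)) u∈S
    bwd : v ∈ S → Sat w (mem x s) ρ
    bwd v∈S =
      let (p , ie , U) = SemicolonAt.vertex-in E refl v∈S
      in p , from (inEdge⇔ v0 (wk s) (extend p ρ)) ie , from (sameVertex⇔ (wk x) v0 (extend p ρ) V U) refl

  means-defective : ∀ {k} {s : Fin k} {ρ : Env w k} {S} → SemicolonAt (toℕ (ρ s)) S →
      Means w (defective s) ρ (Defective S)
  means-defective {s = s} E = means-or
    (means-exG λ p g _ P → means-neg (means-exV λ q v V → means-and (means-mem v0 (wk (wk s)) V E)
        (means-mem v0 v1 V P)))
    (means-exV λ q v V → means-and (means-mem v0 (wk s) V E) (means-neg (means-exG λ p g _ P → means-neg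
      (means-exV λ r u U → means-and (means-mem v0 (wk (wk (wk s))) U E) (means-and (means-mem v0 v1 U P)
          (means-neg (means-same U V)))))))

  Chosen : Formula 1 → Fin m → Set
  Chosen ψ v = ∃ λ (q : Pos) → VertexAt (toℕ q) v × Sat w ψ (λ _ → q)

  means-chosen : ∀ ψ {k} {x : Fin k} {ρ : Env w k} {v} → VertexAt (toℕ (ρ x)) v → Means w (chosen ψ x) ρ
      (Chosen ψ v)
  means-chosen ψ {x = x} {ρ} {v} V = means (mk⇔ fwd bwd)
    where
    ψ⇔ : ∀ q → Sat w (ren (λ _ → v0) ψ) (extend q ρ) ⇔ Sat w ψ (λ _ → q)
    ψ⇔ q = sat-ren w (λ _ → v0) ψ λ _ → refl
    fwd : Sat w (chosen ψ x) ρ → Chosen ψ v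
    fwd (q , sv , fr) =
      let (u , U) = comma-vertex (at-lookup (proj₂ (proj₁ sv)))
      in q , subst (VertexAt (toℕ q)) (≡-sym (to (sameVertex⇔ (wk x) v0 (extend q ρ) V U) sv)) U ,
          to (ψ⇔ q) fr
    bwd : Chosen ψ v → Sat w (chosen ψ x) ρ
    bwd (q , U , fr) = q , from (sameVertex⇔ (wk x) v0 (extend q ρ) V U) refl , from (ψ⇔ q) fr

  -- Decided by evaluating `chosen ψ` at one occurrence of the vertex, instead of deciding
  -- `VertexAt` at every position.
  chosen? : ∀ ψ → Decidable (Chosen ψ)
  chosen? ψ v = map′ (to e) (from e) (sat? w (chosen ψ v0) (λ _ → proj₁ (vertex-position v)))
    where
    e : Sat w (chosen ψ v0) (λ _ → proj₁ (vertex-position v)) ⇔ Chosen ψ v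
    e = sat⇔ (means-chosen ψ {k = 1} {x = v0} (proj₂ (vertex-position v)))

  means-separates : ∀ ψ {ρ} {Q : Fin m → Set} → (∀ v → Chosen ψ v ⇔ Q v) → Means w (separates ψ) ρ
      (Separates Q)
  means-separates ψ Q⇔ = means-and
    (means-neg (means-exG λ p g _ P → means-neg (means-exV λ q v V →
      means-and (means-mem v0 v1 V P) (means-⇔ (means-chosen ψ V) (Q⇔ v)))))
    (means-neg (means-exH λ p h _ P → means-neg (means-exV λ q v V →
      means-and (means-mem v0 v1 V P) (means-neg (means-⇔ (means-chosen ψ V) (Q⇔ v))))))

  means-notDual : ∀ ψ {ρ} {Q : Fin m → Set} → (∀ v → Chosen ψ v ⇔ Q v) →
                  Means w (notDual ψ) ρ ((∃ λ h → h ∈ˡ edges H × Defective h) ⊎ Separates Q)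
  means-notDual ψ Q⇔ = means-or (means-exH λ p h _ P → means-defective P) (means-separates ψ Q⇔)

  accepted-notDual : ∀ ψ {Q : Fin m → Set} → (∀ v → Chosen ψ v ⇔ Q v) →
                     Accepts (notDual ψ) w ⇔ ((∃ λ h → h ∈ˡ edges H × Defective h) ⊎ Separates Q)
  accepted-notDual ψ Q⇔ = ⇔-trans (accepts⇔sat w (notDual ψ)) (sat⇔ (means-notDual ψ Q⇔))

  -- Holds for every `ψ`, with `Chosen ψ` as the separating set, so nothing about the guess has to
  -- be decoded here.
  accepted-sound : ∀ ψ → Accepts (notDual ψ) w → ¬ Dual G H
  accepted-sound ψ ok = Sum.[ (λ (h , h∈H , def) dual → defective⇒¬min def (to (dual h) h∈H))
                                  , separates⇒¬dual (chosen? ψ)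
                                  ] (to (accepted-notDual ψ λ v → mk⇔ id id) ok)

  defect-accepted : ∀ ψ {h} → h ∈ˡ edges H → ¬ MinTransversal G h → Accepts (notDual ψ) w
  -- Acceptance is a Boolean equation and hence stable, so `Defective` need not be decided.
  defect-accepted ψ {h} h∈H ¬mt = decidable-stable (_ ≟ᵇ true) λ rejected →
    ¬mt (¬defective⇒min λ def → rejected (from (accepted-notDual ψ λ v → mk⇔ id id) (inj₁ (h , h∈H , def))))

  -- If `ψ` already means the same at all occurrences of a vertex, closing it under `sameVertex`
  -- changes nothing.
  chosen-means : ∀ ψ {Q : Fin m → Set} → (∀ (ρ : Env w 1) {v} → VertexAt (toℕ (ρ v0)) v → Means w ψ ρ (Q v)) →
                 ∀ v → Chosen ψ v ⇔ Q v
  chosen-means ψ ψ≙ v = mk⇔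
    (λ (q , V , s) → to (sat⇔ (ψ≙ (λ _ → q) V)) s)
    (λ c → let (q , V) = vertex-position v in q , V , from (sat⇔ (ψ≙ (λ _ → q) V)) c)

-- Encoding positions in the guess

bits : ℕ → ℕ → List Bool
bits zero    x = []
bits (suc L) x = isOdd x ∷ bits L ⌊ x /2⌋

nth-bits : ∀ L x {j} → j < L → nth (bits L x) j ≡ just (bitAt x j)
nth-bits (suc L) x {zero} _ = refl
nth-bits (suc L) x {suc j} (s≤s j<L) = nth-bits L ⌊ x /2⌋ j<L

length-bits : ∀ L x → length (bits L x) ≡ L
length-bits zero x = refl
length-bits (suc L) x = cong suc (length-bits L ⌊ x /2⌋)

-- The image of each bit ends in its only zero, so zeros number the bits although the images differ
-- in length.
payload : List Bool → List Bool
payload []           = []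
payload (true  ∷ bs) = true ∷ false ∷ payload bs
payload (false ∷ bs) = false ∷ payload bs

length-payload : ∀ bs → length (payload bs) ≤ length bs + length bs
length-payload [] = z≤n
length-payload (true ∷ bs) = s≤s (≤-trans (s≤s (length-payload bs)) (≤-reflexive (≡-sym (+-suc _ _))))
length-payload (false ∷ bs) = s≤s (≤-trans (length-payload bs) (+-monoʳ-≤ (length bs) (n≤1+n _)))

-- true true false marks the beginning of a block: in the payload a true is
-- always preceded and followed by false.
block : ℕ → ℕ → List Bool
block L x = true ∷ true ∷ false ∷ payload (bits L x)

guessBlock : ℕ → ℕ → List (Fin 8)
guessBlock L x = map guessSym (block L x)

-- Reading positions back from the guess

module Decoding (w : List (Fin 8)) where
  open Positions w

  BlockStart Marked : ℕ → Set
  BlockStart z = At z mark₀ × ∃ λ a → z ≡ suc (suc a) × At a mark₁ × At (suc a) mark₁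
  Marked u = ∃ λ a → u ≡ suc a × At a mark₁

  means-next : ∀ {k} (x y : Fin k) {ρ : Env w k} → Means w (next x y) ρ (toℕ (ρ y) ≡ suc (toℕ (ρ x)))
  means-next x y {ρ} = means (mk⇔
    (λ (x<y , none) → ≤-antisym (≮⇒≥ λ sx<y →
       let (z , z≡) = position (<-trans sx<y (FP.toℕ<n (ρ y)))
       in none (z , ≤-reflexive (≡-sym z≡) , subst (_< toℕ (ρ y)) (≡-sym z≡) sx<y)) x<y)
    λ e → ≤-reflexive (≡-sym e) , λ (z , x<z , z<y) → <⇒≱ z<y (subst (_≤ toℕ z) (≡-sym e) x<z))

  means-sym : ∀ {k} (x : Fin k) {a} {ρ : Env w k} → Means w (sym a x) ρ (At (toℕ (ρ x)) a)
  means-sym x = means (mk⇔ at-lookup lookup-at)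

  means-lt : ∀ {k} (x y : Fin k) {ρ : Env w k} → Means w (lt x y) ρ (toℕ (ρ x) < toℕ (ρ y))
  means-lt x y = means (mk⇔ id id)

  means-bit : ∀ {k} (x y : Fin k) {ρ : Env w k} → Means w (bit x y) ρ (bitAt (toℕ (ρ x)) (toℕ (ρ y)) ≡ true)
  means-bit x y = means (mk⇔ id id)

  means-ex : ∀ {k} {φ : Formula (suc k)} {ρ : Env w k} {Q : Pos → Set} →
      (∀ p → Means w φ (extend p ρ) (Q p)) →
             Means w (ex φ) ρ (∃ Q)
  means-ex φ≙ = means (mk⇔ (λ (p , s) → p , to (sat⇔ (φ≙ p)) s) (λ (p , q) → p , from (sat⇔ (φ≙ p)) q))

  means-marked : ∀ {k} (u : Fin k) {ρ : Env w k} → Means w (marked u) ρ (Marked (toℕ (ρ u)))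
  means-marked u {ρ} = means-⇔
    (means-ex λ p → means-and (means-next v0 (wk u)) (means-sym v0))
    (mk⇔ (λ (p , e , m) → toℕ p , e , m)
         (λ (a , e , m) → let (p , p≡ , ep) = position-at m in p , trans e (cong suc (≡-sym p≡)) ,
                                at-lookup ep))

  means-blockStart : ∀ {k} (d : Fin k) {ρ : Env w k} → Means w (blockStart d) ρ (BlockStart (toℕ (ρ d)))
  means-blockStart d {ρ} = means-⇔
    (means-and (means-sym d) (means-ex λ b → means-and (means-next v0 (wk d)) (means-and (means-sym v0)
      (means-ex λ a → means-and (means-next v0 v1) (means-sym v0)))))
    (mk⇔ (λ (m , b , eb , mb , a , ea , ma) → m , toℕ a , trans eb (cong suc ea) , ma , at-move ea mb)
         (λ (m , a , e , ma , mb) →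
            let (p , p≡ , ep) = position-at ma
                (q , q≡ , eq′) = position-at mb
            in m , q , trans e (cong suc (≡-sym q≡)) , at-lookup eq′ , p ,
                trans q≡ (cong suc (≡-sym p≡)) , at-lookup ep))

  is-mark₀ : ℕ → Bool
  is-mark₀ i = maybe′ (λ a → does (a F.≟ mark₀)) false (nth w i)

  zeros : ℕ → ℕ → ℕ
  zeros d u = countBelow (λ i → does (d <? i) ∧ is-mark₀ i) u

  zeros-step : ∀ {d i a} → d < i → At i a → zeros d (suc i) ≡ zeros d i +
      (if does (a F.≟ mark₀) then 1 else 0)
  zeros-step {d} {i} d<i at rewrite dec-true (d <? i) d<i | at = refl

  zeros-none : ∀ d → zeros d (suc d) ≡ 0
  zeros-none d = countBelow-none _ (suc d) λ i i≤d → cong (_∧ is-mark₀ i)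
      (dec-false (d <? i) (≤⇒≯ (≤-pred i≤d)))

  Cell : ℕ → ℕ → Set
  Cell d u = d < u × At u mark₀ × ¬ (∃ λ (z : Pos) → d < toℕ z × ¬ u < toℕ z × BlockStart (toℕ z))

  means-bitCell : ∀ {k} (d u j : Fin k) {ρ : Env w k} →
    Means w (bitCell d u j) ρ (Cell (toℕ (ρ d)) (toℕ (ρ u)) × zeros (toℕ (ρ d)) (toℕ (ρ u)) ≡ toℕ (ρ j))
  means-bitCell d u j {ρ} = means-⇔
    (means-and (means-and (means-lt d u) (means-sym u)) (means-and
      (means-neg (means-ex λ z → means-and (means-lt (wk d) v0)
          (means-and (means-neg (means-lt (wk u) v0)) (means-blockStart v0))))
      (means (mk⇔ (trans (≡-sym count≡)) (trans count≡)))))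
    (mk⇔ (λ ((a , b) , c , e) → (a , b , c) , e) (λ ((a , b , c) , e) → (a , b) , c , e))
    where
    D = toℕ (ρ d)
    U = toℕ (ρ u)
    f : ℕ → Bool
    f i = (does (D <? i) ∧ does (i <? U)) ∧ is-mark₀ i
    count≡ : tally (length w) (λ p → eval w (and (and (lt (wk d) v0) (lt v0 (wk u))) (sym mark₀ v0))
        (extend p ρ)) ≡ zeros D U
    count≡ = trans (tally-countBelow (length w) _ f λ p → cong ((does (D <? toℕ p) ∧ does (toℕ p <? U)) ∧_)
                      (≡-sym (cong (maybe′ (λ a → does (a F.≟ mark₀)) false) (nth-lookup w p))))
      (trans (countBelow-cut f (<⇒≤ (FP.toℕ<n (ρ u))) λ i U≤i → cong (_∧ is-mark₀ i)
                 (trans (cong (does (D <? i) ∧_) (dec-false (i <? U) (≤⇒≯ U≤i))) (∧-zeroʳ _)))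
             (countBelow-cong U λ i i<U → cong (_∧ is-mark₀ i)
                 (trans (cong (does (D <? i) ∧_) (dec-true (i <? U) i<U)) (∧-identityʳ _))))

  Decodes : ℕ → ℕ → Set
  Decodes d q = BlockStart d × (∀ u → Cell d u → bitAt q (zeros d u) ≡ true ⇔ Marked u)

  means-decodes : ∀ {k} (d q : Fin k) {ρ : Env w k} → Means w (decodes d q) ρ
      (Decodes (toℕ (ρ d)) (toℕ (ρ q)))
  means-decodes d q {ρ} = means-⇔
    (means-and (means-blockStart d) (means-neg (means-ex λ u → means-ex λ j →
      means-and (means-bitCell (wk (wk d)) v1 v0)
        (means-neg (means-and (means-neg (means-and (means-bit (wk (wk q)) v0) (means-neg (means-marked v1))))
                              (means-neg (means-and (means-marked v1)
                                  (means-neg (means-bit (wk (wk q)) v0)))))))))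
    (mk⇔ fwd bwd)
    where
    D = toℕ (ρ d)
    X = toℕ (ρ q)
    Failure : Pos → Pos → Set
    Failure u j = (Cell D (toℕ u) × zeros D (toℕ u) ≡ toℕ j) ×
      ¬ (¬ (bitAt X (toℕ j) ≡ true × ¬ Marked (toℕ u)) × ¬ (Marked (toℕ u) × ¬ bitAt X (toℕ j) ≡ true))
    marked? : ∀ (u : Pos) → Dec (Marked (toℕ u))
    marked? u = map′ (to e) (from e) (sat? w (marked v0) (λ (_ : Fin 1) → u))
      where
      e : Sat w (marked v0) (λ (_ : Fin 1) → u) ⇔ Marked (toℕ u)
      e = sat⇔ (means-marked {1} v0 {λ _ → u})
    fwd : BlockStart D × ¬ (∃ λ u → ∃ λ j → Failure u j) → Decodes D X
    fwd (start , ok) = start , λ u cell → at-pos (position-at (proj₁ (proj₂ cell))) cell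
      where
      at-pos : ∀ {u} → (∃ λ (p : Pos) → toℕ p ≡ u × lookup w p ≡ mark₀) → Cell D u →
          bitAt X (zeros D u) ≡ true ⇔ Marked u
      at-pos (p , refl , _) cell =
        -- The number of zeros before `p` is at most `p`, hence itself a position, so the quantifier
        -- over `j` covers it.
        let (j , j≡) = position (≤-<-trans (countBelow-≤ _ (toℕ p)) (FP.toℕ<n p))
            none : ¬ Failure p j
            none fail = ok (p , j , fail)
        in subst (λ i → bitAt X i ≡ true ⇔ Marked (toℕ p)) j≡ (mk⇔
             (λ b → decidable-stable (marked? p) λ ¬m → none ((cell , ≡-sym j≡) , λ (h , _) → h (b , ¬m)))
             (λ m → decidable-stable (bitAt X (toℕ j) ≟ᵇ true) λ ¬b →
                 none ((cell , ≡-sym j≡) , λ (_ , h) → h (m , ¬b))))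
    bwd : Decodes D X → BlockStart D × ¬ (∃ λ u → ∃ λ j → Failure u j)
    bwd (start , ok) = start , λ (u , j , (cell , e) , fail) →
      let i⇔ = subst (λ i → bitAt X i ≡ true ⇔ Marked (toℕ u)) e (ok (toℕ u) cell)
      in fail ((λ (b , ¬m) → ¬m (to i⇔ b)) , λ (m , ¬b) → ¬b (from i⇔ m))

  different : ∀ {i a b} → At i a → At i b → a ≢ b → ⊥
  different x y a≢b = a≢b (at-unique x y)

  HasBit : ℕ → ℕ → ℕ → Bool → Set
  HasBit d u k b = At u mark₀ × zeros d u ≡ k × (b ≡ true ⇔ Marked u)

  -- State of a left-to-right reading of a payload: `r` is the last zero read, `bs` the bits still
  -- to come, and `zeros d (suc r)` the index of the next bit, which is 0 when `r` is the header
  -- zero `d`.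
  record Cells (d r : ℕ) (bs : List Bool) : Set where
    field
      cell  : ∀ {j b} → nth bs j ≡ just b → ∃ λ u → r < u × u < suc r + length (payload bs) ×
          HasBit d u (zeros d (suc r) + j) b
      index : ∀ {u} → r < u → u < suc r + length (payload bs) → At u mark₀ → ∃ λ j → ∃ λ b →
          nth bs j ≡ just b × HasBit d u (zeros d (suc r) + j) b
      plain : ∀ {z} → r < z → z < suc r + length (payload bs) → ¬ BlockStart z

  -- The induction maintains a zero at `r`: a zero right after it is unmarked, and a one right after
  -- it cannot complete a pair of ones, so no header appears inside the payload.
  cells : ∀ {d} bs {r} → d ≤ r → At r mark₀ → Slice w (suc r) (map guessSym (payload bs)) → Cells d r bs
  cells [] {r} d≤r at s = record
    { cell  = λ ()
    ; index = λ r<u u< _ → contradiction r<u (<⇒≱ (≤-trans u< (≤-reflexive (cong suc (+-identityʳ r)))))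
    ; plain = λ r<u u< _ → contradiction r<u (<⇒≱ (≤-trans u< (≤-reflexive (cong suc (+-identityʳ r))))) }
  cells {d} (false ∷ bs) {r} d≤r at s = record { cell = cell ; index = index ; plain = plain }
    where
    here₀ : At (suc r) mark₀
    here₀ = at-move (+-identityʳ _) (slice-at s refl)
    ih : Cells d (suc r) bs
    ih = cells bs (m≤n⇒m≤1+n d≤r) here₀ (subst (λ i → Slice w i (map guessSym (payload bs)))
        (+-comm (suc r) 1) (slice-++ʳ (mark₀ ∷ []) s))
    module IH = Cells ih
    zeros+ : ∀ j → zeros d (suc (suc r)) + j ≡ zeros d (suc r) + suc j
    zeros+ j = trans (cong (_+ j) (zeros-step (s≤s d≤r) here₀)) (+-assoc (zeros d (suc r)) 1 j)
    end≡ : suc (suc r) + length (payload bs) ≡ suc r + suc (length (payload bs))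
    end≡ = cong suc (≡-sym (+-suc r _))
    head : HasBit d (suc r) (zeros d (suc r) + 0) false
    head = here₀ , ≡-sym (+-identityʳ _) , mk⇔ (λ ()) λ { (_ , refl , m) → ⊥-elim (different at m λ ()) }
    cell : ∀ {j b} → nth (false ∷ bs) j ≡ just b → ∃ λ u → r < u × u < suc r + suc
        (length (payload bs)) × HasBit d u (zeros d (suc r) + j) b
    cell {zero} refl = suc r , ≤-refl , m<m+n (suc r) (s≤s z≤n) , head
    cell {suc j} {b} e = let (u , r<u , u< , h) = IH.cell e
                         in u , <-trans (n<1+n r) r<u , subst (u <_) end≡ u< ,
                             subst (λ k → HasBit d u k b) (zeros+ j) h
    index : ∀ {u} → r < u → u < suc r + suc (length (payload bs)) → At u mark₀ →
            ∃ λ j → ∃ λ b → nth (false ∷ bs) j ≡ just b × HasBit d u (zeros d (suc r) + j) b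
    index {u} r<u u< m with m≤n⇒m<n∨m≡n r<u
    ... | inj₂ refl = 0 , false , refl , head
    ... | inj₁ r′<u = let (j , b , e , h) = IH.index r′<u (subst (u <_) (≡-sym end≡) u<) m
                      in suc j , b , e , subst (λ k → HasBit d u k b) (zeros+ j) h
    plain : ∀ {z} → r < z → z < suc r + suc (length (payload bs)) → ¬ BlockStart z
    plain {z} r<z z< start with m≤n⇒m<n∨m≡n r<z
    plain r<z z< (_ , _ , refl , _ , m) | inj₂ refl = different at m λ ()
    ... | inj₁ r′<z = IH.plain r′<z (subst (z <_) (≡-sym end≡) z<) start
  cells {d} (true ∷ bs) {r} d≤r at s = record { cell = cell ; index = index ; plain = plain }
    where
    here₁ : At (suc r) mark₁
    here₁ = at-move (+-identityʳ _) (slice-at s refl)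
    here₀ : At (suc (suc r)) mark₀
    here₀ = at-move (+-comm (suc r) 1) (slice-at {k = 1} s refl)
    ih : Cells d (suc (suc r)) bs
    ih = cells bs (m≤n⇒m≤1+n (m≤n⇒m≤1+n d≤r)) here₀ (subst (λ i → Slice w i (map guessSym (payload bs)))
        (+-comm (suc r) 2) (slice-++ʳ (mark₁ ∷ mark₀ ∷ []) s))
    module IH = Cells ih
    zeros₀ : zeros d (suc (suc r)) ≡ zeros d (suc r)
    zeros₀ = trans (zeros-step (s≤s d≤r) here₁) (+-identityʳ _)
    zeros+ : ∀ j → zeros d (suc (suc (suc r))) + j ≡ zeros d (suc r) + suc j
    zeros+ j = trans (cong (_+ j) (trans (zeros-step (m≤n⇒m≤1+n (s≤s d≤r)) here₀) (cong (_+ 1) zeros₀)))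
        (+-assoc (zeros d (suc r)) 1 j)
    end≡ : suc (suc (suc r)) + length (payload bs) ≡ suc r + suc (suc (length (payload bs)))
    end≡ = cong suc (trans (cong suc (≡-sym (+-suc r _))) (≡-sym (+-suc r _)))
    head : HasBit d (suc (suc r)) (zeros d (suc r) + 0) true
    head = here₀ , trans zeros₀ (≡-sym (+-identityʳ _)) , mk⇔ (λ _ → suc r , refl , here₁) (λ _ → refl)
    cell : ∀ {j b} → nth (true ∷ bs) j ≡ just b → ∃ λ u → r < u × u < suc r + suc
        (suc (length (payload bs))) × HasBit d u (zeros d (suc r) + j) b
    cell {zero} refl = suc (suc r) , n≤1+n _ , subst (suc (suc r) <_) end≡
        (s≤s (m≤m+n (suc (suc r)) _)) , head
    cell {suc j} {b} e = let (u , r<u , u< , h) = IH.cell e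
                         in u , <-trans (n<1+n r) (<-trans (n<1+n _) r<u) , subst (u <_) end≡ u< ,
                             subst (λ k → HasBit d u k b) (zeros+ j) h
    index : ∀ {u} → r < u → u < suc r + suc (suc (length (payload bs))) → At u mark₀ →
            ∃ λ j → ∃ λ b → nth (true ∷ bs) j ≡ just b × HasBit d u (zeros d (suc r) + j) b
    index {u} r<u u< m with m≤n⇒m<n∨m≡n r<u
    ... | inj₂ refl = ⊥-elim (different here₁ m λ ())
    ... | inj₁ r′<u with m≤n⇒m<n∨m≡n r′<u
    ...   | inj₂ refl = 0 , true , refl , head
    ...   | inj₁ r″<u = let (j , b , e , h) = IH.index r″<u (subst (u <_) (≡-sym end≡) u<) m
                        in suc j , b , e , subst (λ k → HasBit d u k b) (zeros+ j) h
    plain : ∀ {z} → r < z → z < suc r + suc (suc (length (payload bs))) → ¬ BlockStart z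
    plain {z} r<z z< start with m≤n⇒m<n∨m≡n r<z
    ... | inj₂ refl = different here₁ (proj₁ start) λ ()
    ... | inj₁ r′<z with m≤n⇒m<n∨m≡n r′<z
    plain r<z z< (_ , _ , refl , m , _) | inj₁ r′<z | inj₂ refl = different at m λ ()
    ...   | inj₁ r″<z = IH.plain r″<z (subst (z <_) (≡-sym end≡) z<) start

  BlockAt : ℕ → ℕ → ℕ → Set
  BlockAt L st q = Slice w st (guessBlock L q)

  block-start : ∀ {L st q} → BlockAt L st q → BlockStart (suc (suc st))
  block-start {st = st} s = at-move (+-comm st 2) (slice-at {k = 2} s refl) , st , refl ,
    at-move (+-identityʳ st) (slice-at s refl) , at-move (+-comm st 1) (slice-at {k = 1} s refl)

  block-cells : ∀ {L st q} → BlockAt L st q → Cells (suc (suc st)) (suc (suc st)) (bits L q)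
  block-cells {L} {st} {q} s = cells (bits L q) ≤-refl (proj₁ (block-start {L} {st} {q} s))
    (subst (λ i → Slice w i (map guessSym (payload (bits L q)))) (+-comm st 3)
        (slice-++ʳ (mark₁ ∷ mark₁ ∷ mark₀ ∷ []) s))

  block-cell : ∀ {L st q u} → BlockAt L st q → suc (suc st) < u → u < suc (suc (suc st)) + length
      (payload (bits L q)) →
               At u mark₀ → Cell (suc (suc st)) u
  block-cell {L} {st} {q} s d<u u< m = d<u , m , λ (z , d<z , u≮z , start) →
    Cells.plain (block-cells {L} {st} {q} s) d<z (≤-<-trans (≮⇒≥ u≮z) u<) start

  module Guess (L i₀ : ℕ) (qs : List ℕ) (guess : Slice w i₀ (concatMap (guessBlock L) qs))
               (length≡ : length w ≡ i₀ + length (concatMap (guessBlock L) qs))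
               (low : ∀ {i} → i < i₀ → ¬ At i mark₀) where

    module GuessBlocks = Blocks w (guessBlock L) (λ _ → ⊤) (λ _ _ → tt)

    -- Offsets 0 and 1 of a block are ones, and the payload from offset 3 on has no block start;
    -- only offset 2 remains.
    start-block : ∀ {z} → BlockStart z → ∃ λ q → q ∈ˡ qs × ∃ λ st → BlockAt L st q × z ≡ suc (suc st)
    start-block {z} start = go (GuessBlocks.find-block qs tt guess
        (+-cancelˡ-< i₀ _ _ (subst₂ _<_ (≡-sym z≡) length≡ (nth-< w (proj₁ start)))))
      where
      z≡ : i₀ + (z ∸ i₀) ≡ z
      z≡ = m+[n∸m]≡n (≮⇒≥ λ z<i₀ → low z<i₀ (proj₁ start))
      go : (∃ λ q → q ∈ˡ qs × ∃ λ st → ∃ λ j → ⊤ × BlockAt L st q × j < length (guessBlock L q) ×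
          i₀ + (z ∸ i₀) ≡ st + j) →
           ∃ λ q → q ∈ˡ qs × ∃ λ st → BlockAt L st q × z ≡ suc (suc st)
      go (q , q∈ , st , 0 , _ , s , _ , e) = ⊥-elim (different (slice-at {k = 0} s refl)
          (at-move (trans (≡-sym z≡) e) (proj₁ start)) λ ())
      go (q , q∈ , st , 1 , _ , s , _ , e) = ⊥-elim (different (slice-at {k = 1} s refl)
          (at-move (trans (≡-sym z≡) e) (proj₁ start)) λ ())
      go (q , q∈ , st , 2 , _ , s , _ , e) = q , q∈ , st , s , trans (≡-sym z≡) (trans e (+-comm st 2))
      go (q , q∈ , st , suc (suc (suc j)) , _ , s , s≤s (s≤s (s≤s j<)) , e) =
        ⊥-elim (Cells.plain (block-cells {L} {st} {q} s) (subst (suc (suc st) <_) (≡-sym z≡′)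
            (s≤s (s≤s (s≤s (m≤m+n st j)))))
                 (subst (_< suc (suc (suc st)) + length (payload (bits L q))) (≡-sym z≡′)
                   (+-monoʳ-< (suc (suc (suc st)))
                       (≤-trans j< (≤-reflexive (length-map guessSym (payload (bits L q)))))))
                 start)
        where
        z≡′ : z ≡ suc (suc (suc st)) + j
        z≡′ = trans (≡-sym z≡) (trans e (trans (+-suc st _)
            (cong suc (trans (+-suc st _) (cong suc (+-suc st j))))))

    zeros₀ : ∀ d j → zeros d (suc d) + j ≡ j
    zeros₀ d j = cong (_+ j) (zeros-none d)

    -- A block fixes the lowest `L` bits only, so the bound on `x` is what identifies it with the
    -- encoded number.
    decodes-sound : ∀ {d x} → (∀ {q} → q ∈ˡ qs → q < 2 ^ L) → x < 2 ^ L → Decodes d x → x ∈ˡ qs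
    decodes-sound {d} {x} qs< x< (start , ok) = go (start-block start)
      where
      go : (∃ λ q → q ∈ˡ qs × ∃ λ st → BlockAt L st q × d ≡ suc (suc st)) → x ∈ˡ qs
      go (q , q∈ , st , s , refl) = subst (_∈ˡ qs) (bits-injective L (qs< q∈) x< agree-at) q∈
        where
        agree-at : ∀ j → j < L → bitAt q j ≡ bitAt x j
        agree-at j j<L =
          let (u , d<u , u< , m , k≡ , b⇔) = Cells.cell (block-cells {L} {st} {q} s) (nth-bits L q j<L)
              x⇔ = subst (λ k → bitAt x k ≡ true ⇔ Marked u) (trans k≡ (zeros₀ d j))
                  (ok u (block-cell {L} {st} {q} s d<u u< m))
          in true-ext (from x⇔ ∘ to b⇔) (from b⇔ ∘ to x⇔)

    -- Inside the payload the cells carry the bits of `q`. The point that needs care is that no zero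
    -- beyond the payload counts as a cell.
    decodes-complete : ∀ {q} → q ∈ˡ qs → ∃ λ (d : Pos) → Decodes (toℕ d) q
    decodes-complete {q} q∈ = at-start (GuessBlocks.block-split qs q∈ tt guess)
      where
      at-start : (∃ λ st → ∃ λ rest → BlockAt L st q × Slice w (st + length (guessBlock L q))
          (concatMap (guessBlock L) rest) ×
                   st + length (guessBlock L q) + length (concatMap (guessBlock L) rest) ≡ i₀ + length
                       (concatMap (guessBlock L) qs)) →
                 ∃ λ (d : Pos) → Decodes (toℕ d) q
      at-start (st , rest , s , s′ , e) =
        let (p , p≡ , _) = position-at (proj₁ (block-start {L} {st} {q} s))
        in p , subst (λ d → Decodes d q) (≡-sym p≡) (block-start {L} {st} {q} s , ok)
        where
        d = suc (suc st)
        end = suc d + length (payload (bits L q))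
        end≡ : st + length (guessBlock L q) ≡ end
        end≡ = trans (cong (λ l → st + suc (suc (suc l))) (length-map guessSym (payload (bits L q))))
                     (trans (+-suc st _) (cong suc (trans (+-suc st _) (cong suc (+-suc st _)))))
        inside : ∀ {u} → Cell d u → u < end → bitAt q (zeros d u) ≡ true ⇔ Marked u
        inside {u} (d<u , m , _) u< =
          let (j , b , e , _ , k≡ , b⇔) = Cells.index (block-cells {L} {st} {q} s) d<u u< m
              j<L = subst (j <_) (length-bits L q) (nth-< (bits L q) e)
              b≡ = just-injective (trans (≡-sym (nth-bits L q j<L)) e)
          in subst (λ b → b ≡ true ⇔ Marked u)
              (trans (≡-sym b≡) (cong (bitAt q) (≡-sym (trans k≡ (zeros₀ d j))))) b⇔
        -- Past its payload, the next zero belongs to the next block start.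
        outside : ∀ rest → Slice w (st + length (guessBlock L q)) (concatMap (guessBlock L) rest) →
                  st + length (guessBlock L q) + length (concatMap (guessBlock L) rest) ≡ i₀ + length
                      (concatMap (guessBlock L) qs) →
                  ∀ {u} → Cell d u → end ≤ u → ⊥
        outside [] s′ e {u} (_ , m , _) end≤u = <⇒≱ (nth-< w m)
          (≤-trans (≤-reflexive (trans length≡ (trans (≡-sym e) (trans (+-identityʳ _) end≡)))) end≤u)
        outside (q′ ∷ rest) s′ e {u} (d<u , m , none) end≤u = next-start (m≤n⇒m<n∨m≡n end≤u)
          where
          s″ : BlockAt L end q′
          s″ = subst (λ i → Slice w i (guessBlock L q′)) end≡ (slice-++ˡ (guessBlock L q′) s′)
          is-next : u ≡ suc (suc end) ⊎ suc (suc end) < u → ⊥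
          is-next later =
            let (z , z≡ , _) = position-at (proj₁ (block-start {L} {end} {q′} s″))
            in none (z , subst (d <_) (≡-sym z≡) (m≤n⇒m≤1+n (m≤n⇒m≤1+n (m≤m+n (suc d) _))) ,
                     ≤⇒≯ (≤-trans (≤-reflexive z≡) (Sum.[ ≤-reflexive ∘ ≡-sym , <⇒≤ ] later)) ,
                     subst BlockStart (≡-sym z≡) (block-start {L} {end} {q′} s″))
          next-start : end < u ⊎ end ≡ u → ⊥
          next-start (inj₂ refl) = different (at-move (+-identityʳ end) (slice-at {k = 0} s″ refl)) m λ ()
          next-start (inj₁ end<u) with m≤n⇒m<n∨m≡n end<u
          ... | inj₂ refl = different (at-move (+-comm end 1) (slice-at {k = 1} s″ refl)) m λ ()
          ... | inj₁ lt₂ with m≤n⇒m<n∨m≡n lt₂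
          ...   | inj₂ e₂ = is-next (inj₁ (≡-sym e₂))
          ...   | inj₁ lt₃ = is-next (inj₂ lt₃)
        ok : ∀ u → Cell d u → bitAt q (zeros d u) ≡ true ⇔ Marked u
        ok u c with u <? end
        ... | yes u< = inside c u<
        ... | no u≮ = ⊥-elim (outside rest s′ e c (≮⇒≥ u≮))

-- Completeness

does-⇔ : ∀ {A B : Set} {b} → Reflects A b → A ⇔ B → (d : Dec B) → b ≡ does d
does-⇔ (ofʸ a)  e d = ≡-sym (dec-true d (to e a))
does-⇔ (ofⁿ ¬a) e d = ≡-sym (dec-false d (¬a ∘ from e))

-- The default `false` makes positions beyond the word contribute nothing to a count.
pad : ∀ {N} → (Fin N → Bool) → ℕ → Bool
pad {N} f i with i <? N
... | yes i<N = f (fromℕ< i<N)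
... | no _    = false

pad-toℕ : ∀ {N} (f : Fin N → Bool) p → pad f (toℕ p) ≡ f p
pad-toℕ {N} f p with toℕ p <? N
... | yes p<N = cong f (FP.fromℕ<-toℕ p p<N)
... | no p≮N  = ⊥-elim (p≮N (FP.toℕ<n p))

pad-false : ∀ {N} (f : Fin N → Bool) i → (∀ p → toℕ p ≡ i → f p ≡ false) → pad f i ≡ false
pad-false {N} f i off with i <? N
... | yes i<N = off (fromℕ< i<N) (FP.toℕ-fromℕ< i<N)
... | no _    = refl

module LabelPositions {m : ℕ} (G H : Hypergraph m) (w : List (Fin 8)) where
  open Duality G H using (Label; one; but)
  open Positions w
  open Codes m
  open Edges w m

  -- Any digit of the code would serve the formula; the first one is fixed as the representative.
  LabelAt : ℕ → Label → Set
  LabelAt q (one v)   = VertexAt q v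
  LabelAt q (but S v) = ∃ λ p → ∃ λ s → ∃ λ (V : VertexAt p v) →
    VertexAt.start V ≡ q × SemicolonAt s S × Run Inner p s

-- The guess encodes label positions, while the full word contains the guess. The circle is broken
-- by locating labels in a prefix: their description involves no symbol beyond the closing comma or
-- semicolon, so it survives extension to the right.
module _ {m : ℕ} (G H : Hypergraph m) {w w′ : List (Fin 8)}
         (same : ∀ {i} → i < length w → nth w′ i ≡ nth w i) where

  private
    module P = Positions w
    module P′ = Positions w′
    module V = P.Codes m
    module V′ = P′.Codes m
    module D₀ = Edges w m
    module D₁ = Edges w′ m
    module L = LabelPositions G H w
    module L′ = LabelPositions G H w′
  open Duality G H using (Label; one; but)

  slice-prefix : ∀ {i X} → Slice w i X → Slice w′ i X
  slice-prefix {X = X} s .agree k< = let (a , e) = nth-defined X k<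
                                     in trans (same (nth-< w (slice-at s e))) (s .agree k<)

  boundary-prefix : ∀ {P i j} → i ≤ j → j < length w → P.Boundary P i → P′.Boundary P i
  boundary-prefix i≤j j< b refl at = b refl (trans (≡-sym (same (<-trans i≤j j<))) at)

  vertexAt-prefix : ∀ {p v} → V.VertexAt p v → V′.VertexAt p v
  vertexAt-prefix V = V′.vertexAt start end (slice-prefix slice)
    (boundary-prefix (≤-trans (m≤m+n start _) (≤-reflexive (≡-sym end))) (nth-< w comma-at) first)
    where open V.VertexAt V

  semicolonAt-prefix : ∀ {p S} → D₀.SemicolonAt p S → D₁.SemicolonAt p S
  semicolonAt-prefix S = D₁.semicolonAt start end (slice-prefix slice)
    (boundary-prefix (≤-trans (m≤m+n start _) (≤-reflexive (≡-sym end))) (nth-< w semicolon-at) first)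
    where open D₀.SemicolonAt S

  labelAt-prefix : ∀ {q} ℓ → L.LabelAt q ℓ → L′.LabelAt q ℓ
  labelAt-prefix (one v) V = vertexAt-prefix V
  labelAt-prefix (but S v) (p , s , V , e , T , p<s , run) =
    p , s , vertexAt-prefix V , e , semicolonAt-prefix T , p<s ,
    λ p<k k<s at → run p<k k<s (trans (≡-sym (same
        (<-trans k<s (nth-< w (D₀.SemicolonAt.semicolon-at T))))) at)

module Completeness {m : ℕ} (G H : Hypergraph m) (wf : WellFormed G) (w tail : List (Fin 8))
                    (w≡ : w ≡ up (encInst G H) ++ tail) (tail-symbols : All (λ a → 5 ≤ toℕ a) tail) where

  open Instance G H wf w tail w≡ tail-symbols
  open LabelPositions G H w
  open Duality G H
  open Decoding w

  low-position : ∀ {i a} → At i a → toℕ a < 5 → i < n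
  low-position at a<5 with zone at
  ... | zoneG i< = ≤-trans i< (≤-trans (n≤1+n _) (m≤m+n (suc hashPos) _))
  ... | zoneHash refl = m≤m+n (suc hashPos) _
  ... | zoneH k< refl = +-monoʳ-< (suc hashPos) k<
  ... | zoneTail k< refl = ⊥-elim (<⇒≱ a<5 (tail-symbol k< at))

  comma-< : ∀ {i} → At i comma → i < n
  comma-< at = low-position at (m≤m+n 3 2)

  digit-< : ∀ {i a} → At i a → Digit a → i < n
  digit-< at (inj₁ refl) = low-position at (m≤m+n 1 4)
  digit-< at (inj₂ refl) = low-position at (m≤m+n 2 3)

  -- As soon as a vertex exists, its code has a first digit, which is needed to carry a `but` label.
  width-positive : Fin m → 0 < width
  width-positive v = ⌈log₂⌉-mono-≤ {2} {suc m} (s≤s (≤-trans (s≤s z≤n) (FP.toℕ<n v)))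

  label-position : ∀ ℓ → Valid ℓ → ∃ λ q → q < n × LabelAt q ℓ
  label-position (one v) _ = let (p , V) = vertex-position v in toℕ p , comma-< (VertexAt.comma-at V) , V
  label-position (but S v) (S∈ , v∈S) =
    let (i , i< , at) = edge-in-edges (edges G) boundaryG sliceG S∈
        (s , s≡ , _) = position-at (SemicolonAt.semicolon-at at)
        (p , (_ , _ , run) , V) = SemicolonAt.vertex-in at s≡ v∈S
    in VertexAt.start V ,
       ≤-<-trans (≤-trans (m≤m+n (VertexAt.start V) _) (≤-reflexive (≡-sym (VertexAt.end V))))
           (comma-< (VertexAt.comma-at V)) ,
       toℕ p , toℕ s , V , refl , subst (λ i → SemicolonAt i S) (≡-sym s≡) at , run

  comma-not-digit : ∀ {i a} → At i comma → At i a → ¬ Digit a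
  comma-not-digit c e d = absurd (subst Digit (at-unique e c) d)
    where
    absurd : ¬ Digit comma
    absurd (inj₁ ())
    absurd (inj₂ ())

  means-excludedBy : ∀ {k} (q x : Fin k) {ρ : Env w k} {v} ℓ → LabelAt (toℕ (ρ q)) ℓ →
      VertexAt (toℕ (ρ x)) v →
                     Means w (excludedBy q x) ρ (Excludes v ℓ)
  means-excludedBy q x {ρ} {v} (one u) U V = means-⇔
    (means-or (means-same V U) (means {P = ⊥} (mk⇔
      (λ (r , s , ic , _) → comma-not-digit (VertexAt.comma-at U) (nth-lookup w (ρ q))
          (proj₁ (to (inCode⇔ (wk (wk q)) v1 (extend s (extend r ρ))) ic)))
      λ ())))
    (mk⇔ Sum.[ id , ⊥-elim ] inj₁)
  means-excludedBy {k} q x {ρ} {v} (but S u) (p , s , U , q≡ , E , run) V = means-⇔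
    (means-or (means {P = ⊥} (mk⇔ not-comma λ ())) (means {P = v ∈ S × v ≢ u} (mk⇔ fwd bwd)))
    (mk⇔ Sum.[ ⊥-elim , id ] inj₂)
    where
    not-comma : Sat w (sameVertex x q) ρ → ⊥
    not-comma ((_ , c) , _) = comma-not-digit (at-lookup c)
      (at-move (trans (+-identityʳ _) q≡) (VertexAt.bit-at U (width-positive u)))
          (bitSym-digit (bitAt (toℕ u) 0))
    p̂ : ∃ λ (r : Pos) → toℕ r ≡ p × lookup w r ≡ comma
    p̂ = position-at (VertexAt.comma-at U)
    ŝ : ∃ λ (r : Pos) → toℕ r ≡ s × lookup w r ≡ semicolon
    ŝ = position-at (SemicolonAt.semicolon-at E)
    P̂ Ŝ : Pos
    P̂ = proj₁ p̂
    Ŝ = proj₁ ŝ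
    U′ : VertexAt (toℕ P̂) u
    U′ = subst (λ i → VertexAt i u) (≡-sym (proj₁ (proj₂ p̂))) U
    E′ : SemicolonAt (toℕ Ŝ) S
    E′ = subst (λ i → SemicolonAt i S) (≡-sym (proj₁ (proj₂ ŝ))) E
    inCode-q : InCode (ρ q) P̂
    inCode-q = VertexAt.digit-in U (proj₁ (proj₂ p̂)) (width-positive u)
        (trans (≡-sym q≡) (≡-sym (+-identityʳ _)))
    inEdge-p : InEdge P̂ Ŝ
    inEdge-p = proj₂ (proj₂ p̂) , proj₂ (proj₂ ŝ) , subst₂ (Run Inner) (≡-sym (proj₁ (proj₂ p̂)))
        (≡-sym (proj₁ (proj₂ ŝ))) run
    σ : Pos → Pos → Env w (suc (suc k))
    σ r t = extend t (extend r ρ)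
    body : Formula (suc (suc k))
    body = and (mem (wk (wk x)) v0) (neg (sameVertex (wk (wk x)) v1))
    means-body : Means w body (σ P̂ Ŝ) (v ∈ S × v ≢ u)
    means-body = means-and (means-mem (wk (wk x)) v0 V E′) (means-neg (means-same V U′))
    fwd : Sat w (ex (ex (and (inCode (wk (wk q)) v1) (and (inEdge v1 v0) body)))) ρ → v ∈ S × v ≢ u
    fwd (r , t , ic , ie , b) = at-PS (inCode-unique (to (inCode⇔ (wk (wk q)) v1 (σ r t)) ic) inCode-q)
        (to (inEdge⇔ v1 v0 (σ r t)) ie) b
      where
      at-PS : ∀ {r t} → r ≡ P̂ → InEdge r t → Sat w body (σ r t) → v ∈ S × v ≢ u
      at-PS refl ie b = at-S (inEdge-unique ie inEdge-p) b
        where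
        at-S : ∀ {t} → t ≡ Ŝ → Sat w body (σ P̂ t) → v ∈ S × v ≢ u
        at-S refl b = to (sat⇔ means-body) b
    bwd : v ∈ S × v ≢ u → Sat w (ex (ex (and (inCode (wk (wk q)) v1) (and (inEdge v1 v0) body)))) ρ
    bwd c = P̂ , Ŝ , from (inCode⇔ (wk (wk q)) v1 (σ P̂ Ŝ)) inCode-q ,
        from (inEdge⇔ v1 v0 (σ P̂ Ŝ)) inEdge-p , from (sat⇔ means-body) c

  -- Commas and digits occur only in the instance. This supplies the bound that `decodes-sound`
  -- demands of a decoded position.
  excludedBy-< : ∀ {k} (q x : Fin k) (ρ : Env w k) → Sat w (excludedBy q x) ρ → toℕ (ρ q) < n
  excludedBy-< q x ρ sat = Sum.[ (λ ((_ , c) , _) → comma-< (at-lookup c))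
    , (λ (r , s , ic , _) → digit-< (nth-lookup w (ρ q))
        (proj₁ (to (inCode⇔ (wk (wk q)) v1 (extend s (extend r ρ))) ic))) ]
    (to (or⇔ (sameVertex x q) (ex (ex (and (inCode (wk (wk q)) v1)
        (and (inEdge v1 v0) (and (mem (wk (wk x)) v0) (neg (sameVertex (wk (wk x)) v1))))))) ρ) sat)

  -- Positions up to the hash, positions in the tail, and symbols other than semicolons contribute
  -- nothing; what remains is one position per edge of `H`.
  tally-edges : ∀ {k} (φ : Formula (suc k)) (ρ : Env w k) {Q : Subset m → Set} (Q? : Decidable Q) →
    (∀ p S → SemicolonAt (toℕ p) S → Means w φ (extend p ρ) (Q S)) →
    tally (length w) (λ p → eval w (and (inH v0) φ) (extend p ρ)) ≡ count Q? (edges H)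
  tally-edges φ ρ {Q} Q? φ≙ =
    trans (tally-countBelow (length w) g f λ p → ≡-sym (pad-toℕ g p))
    (trans (countBelow-cut f n≤ λ i n≤i → pad-false g i λ p p≡ → not-sat p λ ((ep , _) , _) →
        <⇒≱ (low-position (at-move p≡ (at-lookup ep)) (m≤m+n 4 1)) n≤i)
    (trans (count-edges f Q? (edges H) boundaryH sliceH hit λ {i} {a} at a≢ → pad-false g i λ p p≡ →
        not-sat p λ ((ep , _) , _) → a≢ (at-unique at (at-move p≡ (at-lookup ep))))
    (cong (_+ count Q? (edges H)) (countBelow-none f (suc hashPos) λ i i≤ → pad-false g i λ p p≡ →
       not-sat p λ ((_ , h , eh , h<p) , _) → <⇒≱ (subst₂ _<_ (hash-unique (at-lookup eh)) p≡ h<p)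
           (≤-pred i≤)))))
    where
    g : Pos → Bool
    g p = eval w (and (inH v0) φ) (extend p ρ)
    f : ℕ → Bool
    f = pad g
    n≤ : n ≤ length w
    n≤ = ≤-trans (m≤m+n n (length tail)) (≤-reflexive (≡-sym length-w))
    not-sat : ∀ p → ¬ Sat w (and (inH v0) φ) (extend p ρ) → g p ≡ false
    not-sat p ¬s = dec-false (sat? w (and (inH v0) φ) (extend p ρ)) ¬s
    hit : ∀ {i S} → suc hashPos ≤ i → SemicolonAt i S → S ∈ˡ edges H → f i ≡ does (Q? S)
    hit {i} {S} h<i E _ = at-pos (position-at (SemicolonAt.semicolon-at E)) h<i E
      where
      at-pos : ∀ {i} → (∃ λ (p : Pos) → toℕ p ≡ i × lookup w p ≡ semicolon) → suc hashPos ≤ i →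
          SemicolonAt i S → f i ≡ does (Q? S)
      at-pos (p , refl , ep) h<p E = trans (pad-toℕ g p)
          (does-⇔ (sat-reflects w (and (inH v0) φ) (extend p ρ))
        (mk⇔ (λ (_ , s) → to (sat⇔ (φ≙ p S E)) s)
             (λ q → let (h , h≡ , eh) = position-at hash-at
                    in (ep , h , eh , subst (_< toℕ p) (≡-sym h≡) h<p) , from (sat⇔ (φ≙ p S E)) q)) (Q? S))

  length-edges : ∀ es → length es ≤ length (edgesCode es)
  length-edges [] = z≤n
  length-edges (S ∷ es) = ≤-trans (s≤s (length-edges es))
      (≤-trans (+-monoˡ-≤ _ (≤-trans (s≤s z≤n) (≤-reflexive (≡-sym (length-edgeBlock S)))))
                                   (≤-reflexive (≡-sym (length-++ (edgeBlock S)))))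

  -- Every edge owns a semicolon, and the hash makes the inequality strict, as `certificate`
  -- requires.
  length-edgesH< : length (edges H) < n
  length-edgesH< = s≤s (≤-trans (length-edges (edges H)) (m≤n+m _ hashPos))

  module Guessed (L : ℕ) (n≤2^L : n ≤ 2 ^ L) (ls : List Label) (qs : List ℕ)
    (qs< : ∀ {q} → q ∈ˡ qs → q < n)
    (label-of : ∀ {q} → q ∈ˡ qs → ∃ λ ℓ → ℓ ∈ˡ ls × LabelAt q ℓ)
    (position-of : ∀ {ℓ} → ℓ ∈ˡ ls → ∃ λ q → q ∈ˡ qs × LabelAt q ℓ)
    (tail≡ : tail ≡ # 5 ∷ concatMap (guessBlock L) qs) where

    n< : n < length w
    n< = subst (n <_) (≡-sym (trans length-w (cong (λ t → n + length t) tail≡))) (m<m+n n (s≤s z≤n))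

    guess : Slice w (suc n) (concatMap (guessBlock L) qs)
    guess = subst (λ i → Slice w i (concatMap (guessBlock L) qs)) (+-comm n 1)
              (slice-++ʳ (# 5 ∷ []) (subst (Slice w n) tail≡ slice-tail))

    length≡ : length w ≡ suc n + length (concatMap (guessBlock L) qs)
    length≡ = trans length-w (trans (cong (λ t → n + length t) tail≡) (+-suc n _))

    low : ∀ {i} → i < suc n → ¬ At i mark₀
    low {i} i≤n at with zone at
    ... | zoneG i< = contradiction (edges-symbol (edges G) sliceG i< at) λ { (s≤s (s≤s (s≤s ()))) }
    ... | zoneHash refl = different at hash-at λ ()
    ... | zoneH k< refl = contradiction (edges-symbol (edges H) sliceH k< at) λ { (s≤s (s≤s (s≤s ()))) }
    ... | zoneTail {zero} k< refl = different at (slice-at {k = 0} (subst (Slice w n) tail≡ slice-tail)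
        refl) λ ()
    ... | zoneTail {suc k} k< refl = <⇒≱ i≤n (≤-trans (s≤s (m≤m+n n k)) (≤-reflexive (≡-sym (+-suc n k))))

    open Guess L (suc n) qs guess length≡ low

    means-excluded : ∀ {k} (x : Fin k) {ρ : Env w k} {v} → VertexAt (toℕ (ρ x)) v →
        Means w (excluded x) ρ (Excluded ls v)
    means-excluded x {ρ} {v} V = means (mk⇔ fwd bwd)
      where
      fwd : Sat w (excluded x) ρ → Excluded ls v
      fwd (q , (d , dec) , eb) =
        let q∈ = decodes-sound (λ q∈ → ≤-trans (qs< q∈) n≤2^L)
              (≤-trans (excludedBy-< v0 (wk x) (extend q ρ) eb) n≤2^L)
                   (to (sat⇔ (means-decodes v0 v1 {extend d (extend q ρ)})) dec)
            (ℓ , ℓ∈ , at) = label-of q∈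
        in lose ℓ∈ (to (sat⇔ (means-excludedBy v0 (wk x) {extend q ρ} ℓ at V)) eb)
      bwd : Excluded ls v → Sat w (excluded x) ρ
      bwd any =
        let (ℓ , ℓ∈ , e) = find any
            (q , q∈ , at) = position-of ℓ∈
            (d , dec) = decodes-complete q∈
            (p , p≡) = position (<-trans (qs< q∈) n<)
        in p , (d , from (sat⇔ (means-decodes v0 v1 {extend d (extend p ρ)}))
            (subst (Decodes (toℕ d)) (≡-sym p≡) dec)) ,
           from (sat⇔ (means-excludedBy v0 (wk x) {extend p ρ} ℓ
               (subst (λ i → LabelAt i ℓ) (≡-sym p≡) at) V)) e

    means-live : ∀ {k} (s : Fin k) {ρ : Env w k} {S} → SemicolonAt (toℕ (ρ s)) S → Means w (live s) ρ
        (Live ls S)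
    means-live s E = means-neg (means-exV λ p v V → means-and (means-mem v0 (wk s) V E) (means-excluded v0 V))

    opaque
      unfolding frequent

      means-frequent : ∀ (ρ : Env w 1) {v} → VertexAt (toℕ (ρ v0)) v → Means w frequent ρ (Frequent ls v)
      means-frequent ρ {v} V = means-and (means-neg (means-excluded v0 V)) (means (mk⇔ fwd bwd))
        where
        φ₁ φ₂ : Formula 4
        φ₁ = and (live v0) (mem v3 v0)
        φ₂ = and (live v0) (neg (mem v3 v0))
        with≡ : ∀ i j → tally (length w) (λ p → eval w (and (inH v0) φ₁)
            (extend p (extend j (extend i ρ)))) ≡ #with ls v
        with≡ i j = tally-edges φ₁ (extend j (extend i ρ)) (λ h → live? ls h ×-dec (v ∈? h)) λ p S E →
            means-and (means-live v0 E) (means-mem v3 v0 V E)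
        without≡ : ∀ i j → tally (length w) (λ p → eval w (and (inH v0) φ₂)
            (extend p (extend j (extend i ρ)))) ≡ #without ls v
        without≡ i j = tally-edges φ₂ (extend j (extend i ρ)) (λ h → live? ls h ×-dec ¬? (v ∈? h))
            λ p S E → means-and (means-live v0 E) (means-neg (means-mem v3 v0 V E))
        majority : Formula 1
        majority = ex (ex (and (cnt v1 (and (inH v0) φ₁)) (and (cnt v0 (and (inH v0) φ₂)) (neg (lt v1 v0)))))
        fwd : Sat w majority ρ → #without ls v ≤ #with ls v
        fwd (i , j , ci , cj , i≮j) = subst₂ _≤_ (trans (≡-sym cj) (without≡ i j))
            (trans (≡-sym ci) (with≡ i j)) (≮⇒≥ i≮j)
        -- A count can be named in a formula only by a position, so it must stay below the length of
        -- the word.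
        small : ∀ {P : Subset m → Set} (P? : Decidable P) → count P? (edges H) < length w
        small P? = <-trans (≤-<-trans (length-filter P? (edges H)) length-edgesH<) n<
        bwd : #without ls v ≤ #with ls v → Sat w majority ρ
        bwd le =
          let (i , i≡) = position (small (λ h → live? ls h ×-dec (v ∈? h)))
              (j , j≡) = position (small (λ h → live? ls h ×-dec ¬? (v ∈? h)))
          in i , j , trans (with≡ i j) (≡-sym i≡) , trans (without≡ i j) (≡-sym j≡) ,
             ≤⇒≯ (subst₂ _≤_ (≡-sym j≡) (≡-sym i≡) le)

    separation-accepted : Separates (Frequent ls) → Accepts (notDual frequent) w
    separation-accepted sep = from (accepted-notDual frequent (chosen-means frequent {Frequent ls}
        (λ ρ {v} → means-frequent ρ {v}))) (inj₂ sep)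

-- Length of the guess and assembly of both directions

guessTail : ℕ → List ℕ → List (Fin 8)
guessTail L qs = # 5 ∷ concatMap (guessBlock L) qs

guessBits : ℕ → List ℕ → List Bool
guessBits L = concatMap (block L)

checkerWord-guess : ∀ x L qs → checkerWord x (guessBits L qs) ≡ up x ++ guessTail L qs
checkerWord-guess x L qs = cong (λ t → up x ++ # 5 ∷ t) (map-concatMap guessSym (block L) qs)

guess-symbols : ∀ y → All (λ a → 5 ≤ toℕ a) (# 5 ∷ map guessSym y)
guess-symbols y = ≤-refl ∷ All.map⁺ (All.tabulate λ {b} _ → symbol b)
  where
  symbol : ∀ b → 5 ≤ toℕ (guessSym b)
  symbol false = n≤1+n 5
  symbol true = m≤n+m 5 2

length-guessBits : ∀ L qs → length (guessBits L qs) ≤ length qs * (3 + (L + L))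
length-guessBits L [] = z≤n
length-guessBits L (q ∷ qs) = ≤-trans (≤-reflexive (length-++ (block L q)))
  (+-mono-≤ (+-monoʳ-≤ 3 (≤-trans (length-payload (bits L q))
      (≤-reflexive (cong₂ _+_ (length-bits L q) (length-bits L q)))))
            (length-guessBits L qs))

-- Origin of the constant 5: a block has 3 header symbols and at most two symbols per bit, and 3 +
-- 2L is at most 5L once L is positive. For L = 0 there are no blocks.
guess-bound : ∀ {K} L → K ≤ L → K * (3 + (L + L)) ≤ 5 * L ^ 2 + 5
guess-bound zero z≤n = z≤n
guess-bound {K} L@(suc _) K≤L = ≤-trans (*-mono-≤ K≤L cells≤) (≤-trans (≤-reflexive rearrange) (m≤m+n _ 5))
  where
  cells≤ : 3 + (L + L) ≤ 5 * L
  cells≤ = ≤-trans (+-mono-≤ (*-monoʳ-≤ 3 {1} {L} (s≤s z≤n))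
      (≤-reflexive (cong (L +_) (≡-sym (+-identityʳ L))))) (≤-reflexive (≡-sym (*-distribʳ-+ L 3 2)))
  rearrange : L * (5 * L) ≡ 5 * L ^ 2
  rearrange = trans (≡-sym (*-assoc L 5 L)) (trans (cong (_* L) (*-comm L 5))
      (trans (*-assoc 5 L L) (cong (λ k → 5 * (L * k)) (≡-sym (*-identityʳ L)))))

module Solution {m : ℕ} (G H : Hypergraph m) (wf : WellFormed G) where

  open Duality G H

  input : List (Fin 5)
  input = encInst G H

  size : ℕ
  size = ⌈log₂ (length input) ⌉

  Certificate : Set
  Certificate = ∃ λ y → length y ≤ 5 * size ^ 2 + 5 × Accepts (notDual frequent) (checkerWord input y)

  sound-certificate : Certificate → ¬ Dual G H
  sound-certificate (y , _ , ok) =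
    Instance.accepted-sound G H wf (checkerWord input y) _ refl (guess-symbols y) frequent ok

  -- The first disjunct of `notDual` finds the defect in the instance alone, so the empty guess
  -- suffices.
  defect-certificate : ∀ {h} → h ∈ˡ edges H → ¬ MinTransversal G h → Certificate
  defect-certificate h∈H ¬mt = [] , z≤n ,
    Instance.defect-accepted G H wf (checkerWord input []) _ refl (guess-symbols []) frequent h∈H ¬mt

  record Positioned (n : ℕ) (At : ℕ → Label → Set) (ls : List Label) : Set where
    field
      qs          : List ℕ
      length-qs   : length qs ≡ length ls
      qs<         : ∀ {q} → q ∈ˡ qs → q < n
      label-of    : ∀ {q} → q ∈ˡ qs → ∃ λ ℓ → ℓ ∈ˡ ls × At q ℓ
      position-of : ∀ {ℓ} → ℓ ∈ˡ ls → ∃ λ q → q ∈ˡ qs × At q ℓ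

  positioned : ∀ {n At ls} → All (λ ℓ → ∃ λ q → q < n × At q ℓ) ls → Positioned n At ls
  positioned [] = record { qs = [] ; length-qs = refl ; qs< = λ () ; label-of = λ () ; position-of = λ () }
  positioned {n} {At} {ℓ ∷ ls} ((q , q<n , at) ∷ rest) = record
    { qs          = q ∷ qs
    ; length-qs   = cong suc length-qs
    ; qs<         = λ { (here refl) → q<n ; (there q∈) → qs< q∈ }
    ; label-of    = λ { (here refl) → ℓ , here refl , at ; (there q∈) → Product.map₂ (Product.map₁ there)
        (label-of q∈) }
    ; position-of = λ { (here refl) → q , here refl , at ; (there ℓ∈) → Product.map₂ (Product.map₁ there)
        (position-of ℓ∈) }
    }
    where open Positioned (positioned {n} {At} {ls} rest)

  -- Label positions are read off the word without a guess, so that the guess can encode them.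
  bare : List (Fin 8)
  bare = up input ++ []

  module Bare = Instance G H wf bare [] refl []
  module BareLabels = LabelPositions G H bare

  label-positions : ∀ {ls} → All Valid ls → Positioned Bare.n BareLabels.LabelAt ls
  label-positions valid = positioned (All.map (λ {ℓ} ok → Completeness.label-position G H wf bare [] refl
      [] ℓ ok) valid)

  separation-certificate : ∀ {ls} → length ls ≤ size → Positioned Bare.n BareLabels.LabelAt ls →
      Separates (Frequent ls) → Certificate
  separation-certificate {ls} len positions sep =
    guessBits size qs ,
    ≤-trans (length-guessBits size qs) (guess-bound size (≤-trans (≤-reflexive length-qs) len)) ,
      (Completeness.Guessed.separation-accepted G H wf w tail (checkerWord-guess input size qs)
        (subst (All (λ a → 5 ≤ toℕ a)) (cong (# 5 ∷_) (map-concatMap guessSym (block size) qs))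
            (guess-symbols (guessBits size qs)))
        size n≤2^L ls qs qs<
        (λ q∈ → let (ℓ , ℓ∈ , at) = label-of q∈ in ℓ , ℓ∈ , labelAt-prefix G H prefix ℓ at)
        (λ {ℓ} ℓ∈ → let (q , q∈ , at) = position-of ℓ∈ in q , q∈ , labelAt-prefix G H prefix ℓ at)
        refl sep)
    where
    open Positioned positions
    w tail : List (Fin 8)
    w = checkerWord input (guessBits size qs)
    tail = guessTail size qs
    n≤2^L : Bare.n ≤ 2 ^ size
    n≤2^L = ≤-trans (≤-reflexive (≡-sym Bare.length-instance)) (n≤2^⌈log₂n⌉ (length input))
    prefix : ∀ {i} → i < length bare → nth w i ≡ nth bare i
    prefix {i} i< = trans (nth-++ˡ (up input) (subst (λ b → i < length b) (++-identityʳ (up input)) i<))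
                          (cong (λ b → nth b i) (≡-sym (++-identityʳ (up input))))

  certificate⇒ : (∃ λ ls → length ls ≤ size × All Valid ls × Separates (Frequent ls)) → Certificate
  certificate⇒ (ls , len , valid , sep) = separation-certificate len (label-positions valid) sep

  find-certificate : ¬ Dual G H → Certificate
  find-certificate ¬dual = by-cases (All.all? minTransversal? (edges H))
    where
    -- `size` plays two roles: it bounds the number of halvings, hence of labels, and it is the
    -- number of bits per label. The guess is therefore quadratic in it.
    bound : length (edges H) < 2 ^ size
    bound = ≤-trans (Completeness.length-edgesH< G H wf bare [] refl [])
        (≤-trans (≤-reflexive (≡-sym Bare.length-instance)) (n≤2^⌈log₂n⌉ (length input)))
    by-cases : Dec (All (MinTransversal G) (edges H)) → Certificate
    by-cases (no ¬min) = let (h , h∈H , ¬mt) = find (All.¬All⇒Any¬ minTransversal? (edges H) ¬min)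
                               in defect-certificate h∈H ¬mt
    by-cases (yes min) = certificate⇒ (certificate size bound ¬dual λ h h∈H → All.lookup min h∈H)

theorem2 : CoDualInGC-log²-TC⁰
theorem2 = 5 , notDual frequent , λ m G H wfG _ →
  mk⇔ (Solution.find-certificate G H wfG) (Solution.sound-certificate G H wfG)
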